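{- For every $k\ge 2$ there is a constant $c_k$ such that for all oriented trees $T_1,\dots,T_k$, $$\mathrm{R}(T_1,\dots,T_k)\le c_k\,|T_1|\cdots|T_k|\left(\sum_{i=1}^k\frac{1}{|T_i|}\right).$$
   Context: An oriented tree is a directed graph without loops or bidirected edges whose underlying undirected graph is a tree; $|T|$ is its number of vertices. The complete directed graph $\overleftrightarrow{K}_n$ has an edge $xy$ for every ordered pair $(x,y)$ of distinct vertices (so $xy$ and $yx$ are both edges and may receive different colours). $\mathrm{R}(G_1,\dots,G_k)$ is the least $n$ such that in every colouring of the edges of $\overleftrightarrow{K}_n$ with colours $1,\dots,k$ there is an $i$ and a copy (subgraph isomorphic as a directed graph) of $G_i$ all of whose edges have colour $i$. -}

module Defs where

open import Level using (0ℓ)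
open import Data.Nat.Base using (ℕ; NonZero; _≤_; _+_)
open import Data.Integer.Base using (+_)
open import Data.Rational.Base using (ℚ; _/_)
open import Data.Rational.Properties using (+-0-commutativeMonoid; *-1-commutativeMonoid)
open import Data.Fin.Base using (Fin; zero; suc; inject₁; fromℕ)
open import Data.Fin.Properties using (_≟_)
open import Data.Product.Base using (Σ; ∃; _×_; _,_)
open import Function.Definitions using (Injective)
open import Relation.Binary.Core using (Rel)
open import Relation.Binary.Definitions using (Decidable; Irreflexive; Asymmetric)
open import Relation.Binary.Construct.Closure.Symmetric using (SymClosure)
open import Relation.Binary.Construct.Closure.Equivalence using (EqClosure)
open import Relation.Binary.PropositionalEquality.Core using (_≡_; _≢_)
open import Relation.Nullary.Decidable.Core using (Dec; yes; no; map′)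
open import Relation.Nullary.Negation.Core using (¬_)

import Algebra.Properties.CommutativeMonoid.Sum as Sum

open Sum +-0-commutativeMonoid public using (sum)
open Sum *-1-commutativeMonoid public using () renaming (sum to product)

-- Up to isomorphism a finite directed graph has vertex set Fin n.  Decidability
-- of the edge relation is automatic classically.
record Digraph : Set₁ where
  field
    order : ℕ
    Edge  : Rel (Fin order) 0ℓ
    edge? : Decidable Edge

  Vertex : Set
  Vertex = Fin order

-- The cycle v 0, …, v (m + 2), v 0: at least three vertices, all distinct.
record Cycle {n : ℕ} (Adj : Rel (Fin n) 0ℓ) : Set where
  field
    m         : ℕ
    v         : Fin (3 + m) → Fin n
    injective : Injective _≡_ _≡_ v
    step      : ∀ (i : Fin (2 + m)) → Adj (v (inject₁ i)) (v (suc i))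
    close     : Adj (v (fromℕ (2 + m))) (v zero)

-- SymClosure Edge is the adjacency relation of the underlying undirected graph;
-- EqClosure Edge x y is the type of walks in that graph from x to y.
record OrientedTree : Set₁ where
  field
    digraph : Digraph
  open Digraph digraph public
  field
    nonempty     : NonZero order
    loopless     : Irreflexive _≡_ Edge
    unidirected  : Asymmetric Edge
    connected    : ∀ x y → EqClosure Edge x y
    acyclic      : ¬ Cycle (SymClosure Edge)

-- As a rational number.
∣_∣ : OrientedTree → ℚ
∣ T ∣ = + OrientedTree.order T / 1

1/∣_∣ : OrientedTree → ℚ
1/∣ T ∣ = (+ 1 / order) {{nonempty}}
  where open OrientedTree T

-- G is isomorphic to a (not necessarily induced) subgraph of H.
record Copy (G H : Digraph) : Set where
  private
    module G = Digraph G
    module H = Digraph H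
  field
    embed     : G.Vertex → H.Vertex
    injective : Injective _≡_ _≡_ embed
    preserves : ∀ {x y} → G.Edge x y → H.Edge (embed x) (embed y)

-- A k-colouring of the edges of the complete directed graph on Fin n.  A proof
-- of x ≢ y is definitionally irrelevant, so the colour depends only on (x , y).
Colouring : ℕ → ℕ → Set
Colouring n k = (x y : Fin n) → x ≢ y → Fin k

-- The spanning subgraph formed by the edges of colour i.
colourClass : ∀ {n k} → Colouring n k → Fin k → Digraph
colourClass {n} c i = record
  { order = n
  ; Edge  = λ x y → Σ (x ≢ y) λ x≢y → c x y x≢y ≡ i
  ; edge? = dec
  }
  where
  dec : ∀ x y → Dec (Σ (x ≢ y) λ x≢y → c x y x≢y ≡ i)
  dec x y with x ≟ y
  ... | yes x≡y = no λ (x≢y , _) → x≢y x≡y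
  ... | no  x≢y = map′ (x≢y ,_) (λ (_ , eq) → eq) (c x y x≢y ≟ i)

Arrows : ∀ {k} → ℕ → (Fin k → Digraph) → Set
Arrows {k} n G = (c : Colouring n k) → ∃ λ i → Copy (G i) (colourClass c i)

-- r = R(G₁, …, Gₖ).
IsRamseyNumber : ∀ {k} → (Fin k → Digraph) → ℕ → Set
IsRamseyNumber G r = Arrows r G × (∀ n → Arrows n G → r ≤ n)

{-# OPTIONS --safe #-}

-- Suppose colour i contains no copy of T i, and induct on the number k of colours and then on the
-- sizes of the trees. Shrink two sizes by a factor 2 ^ d: by induction, if some large set misses a
-- small tree in colour a, then all its large subsets contain all small trees in colour b. So one
-- colour, c say, contains all small trees in every large subset of some large set;
-- and long directed paths of colour c exist in every large set (for k = 2 by a strong form of the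
-- Gallai–Roy theorem; for k ≥ 3 because a digraph without them has a large independent set, to which
-- the case k - 1 applies). If c is not sparse on any large set, then arborescences are assembled from
-- paths and small trees, in d rounds each of which halves the subtrees hanging from a path, and T c is
-- assembled from arborescences placed alternately on the two sides of a bipartite graph of large
-- minimum degree. Hence c is sparse on a large set, and may be disregarded there. When one colour is
-- left it has large degrees and contains its tree greedily. The losses are polynomial in d, the gain is 2 ^ d.
module Submission where

import Data.Integer.Base as ℤ
import Data.Integer.Properties as ℤₚ
import Data.Nat.Properties as ℕ
import Data.Rational.Properties as ℚₚ
import Data.Rational.Unnormalised.Base as ℚᵘ
import Data.Rational.Unnormalised.Properties as ℚᵘₚ
import Relation.Binary.Construct.Closure.Symmetric as Sym

open import Data.Bool.Base using (Bool; true; false; _∧_; _∨_; not; T)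
open import Data.Bool.Properties using (T-∧; T-∨)
open import Data.Empty using (⊥; ⊥-elim)
open import Data.Fin.Base using (Fin; zero; suc; punchIn; punchOut; inject₁; fromℕ)
open import Data.Fin.Properties using (_≟_; any?; all?; punchInᵢ≢i; punchIn-punchOut)
open import Data.List.Base using (List; []; _∷_; length)
open import Data.Nat.Base
  using (ℕ; zero; suc; _+_; _*_; _∸_; _^_; _≤_; _<_; z≤n; s≤s; s≤s⁻¹; >-nonZero; NonZero)
open import Data.Nat.DivMod using (_/_; m≡m%n+[m/n]*n; m%n<n; m/n*n≤m; m/n<m; m/n≤m)
open import Data.Nat.Properties hiding (_≟_)
open import Data.Nat.Tactic.RingSolver using (solve-∀)
open import Data.Product.Base using (∃; _×_; _,_; proj₁; proj₂)
open import Data.Rational.Base as ℚ using (ℚ)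
open import Data.Sum.Base using (_⊎_; inj₁; inj₂; [_,_]′)
open import Data.Unit.Base using (⊤; tt)
open import Function.Base using (_∘_; const; id; case_of_)
open import Function.Bundles using (Equivalence)
open import Relation.Binary.Construct.Closure.ReflexiveTransitive using (Star; ε; _◅_)
open import Relation.Binary.PropositionalEquality
  using (_≡_; _≢_; refl; sym; trans; cong; cong₂; subst; module ≡-Reasoning)
open import Relation.Nullary.Decidable.Core
  using (Dec; yes; no; ⌊_⌋; toWitness; fromWitness; _×-dec_; _→-dec_; map′; ¬?)
open import Relation.Nullary.Negation.Core using (¬_)
open import Defs

open Sym using (SymClosure)

-- Two sizes are shrunk because each term of the sum of cofactors omits one factor: shrinking one
-- size would leave a term unchanged, shrinking two divides every term by at least 2 ^ d. The price
-- is that the induction does not say which of the two colours is rich in small trees. Set sizes are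
-- measured in units of `D + q`, where `q` is a multiple of that sum and `D` bounds the degrees in
-- disregarded colours. The factors lost then depend on `k` and `d` only, so `d` can be fixed before
-- the trees. A subtree is sought inside the neighbourhood of the vertex it hangs from: wherever it
-- turns up there, its root is adjacent to that vertex. So lower bounds on degrees suffice, without
-- control of where a subtree is rooted. For two colours the bound n₁ + n₂ is linear. A level of the
-- ordinary Gallai-Roy theorem is only guaranteed a fraction 1 / n₁ of the vertices, which would
-- give n₁ n₂; hence the strong form. For k ≥ 3 the factor n₁ is affordable: the sum of cofactors is
-- at least n₁ times the same sum for the other sizes.

private variable N : ℕ

-- Sums and finite sets

opaque
  ∑ : (Fin N → ℕ) → ℕ
  ∑ {zero}  f = 0
  ∑ {suc N} f = f zero + ∑ (f ∘ suc)

  ∑-mono : ∀ {f g : Fin N → ℕ} → (∀ x → f x ≤ g x) → ∑ f ≤ ∑ g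
  ∑-mono {zero}  h = z≤n
  ∑-mono {suc N} h = +-mono-≤ (h zero) (∑-mono (h ∘ suc))

  ∑-cong : ∀ {f g : Fin N → ℕ} → (∀ x → f x ≡ g x) → ∑ f ≡ ∑ g
  ∑-cong {zero}  h = refl
  ∑-cong {suc N} h = cong₂ _+_ (h zero) (∑-cong (h ∘ suc))

  ∑-zero : ∑ {N} (const 0) ≡ 0
  ∑-zero {zero}  = refl
  ∑-zero {suc N} = ∑-zero {N}

  ∑-+ : ∀ (f g : Fin N → ℕ) → ∑ (λ x → f x + g x) ≡ ∑ f + ∑ g
  ∑-+ {zero}  f g = refl
  ∑-+ {suc N} f g =
    trans (cong (f zero + g zero +_) (∑-+ (f ∘ suc) (g ∘ suc))) (interchange (f zero) (g zero) _ _)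
    where
    interchange : ∀ a b c d → (a + b) + (c + d) ≡ (a + c) + (b + d)
    interchange = solve-∀

  ∑-* : ∀ c (f : Fin N → ℕ) → ∑ (λ x → c * f x) ≡ c * ∑ f
  ∑-* {zero}  c f = sym (*-zeroʳ c)
  ∑-* {suc N} c f = trans (cong (c * f zero +_) (∑-* c (f ∘ suc))) (sym (*-distribˡ-+ c (f zero) _))

  ∑-swap : ∀ {M} (f : Fin M → Fin N → ℕ) → ∑ (λ x → ∑ (f x)) ≡ ∑ (λ y → ∑ (λ x → f x y))
  ∑-swap {N} {zero}  f = sym (∑-zero {N})
  ∑-swap {N} {suc M} f =
    trans (cong (∑ (f zero) +_) (∑-swap (f ∘ suc))) (sym (∑-+ (f zero) _))

𝟙 : Bool → ℕ
𝟙 true  = 1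
𝟙 false = 0

Sub : ℕ → Set
Sub N = Fin N → Bool

infix 4 _∈_ _∉_ _⊆_
-- A record rather than `T (U x)` itself, so that unification can recover `x` and `U` from a
-- membership.
record _∈_ (x : Fin N) (U : Sub N) : Set where
  constructor ⟨_⟩
  field holds : T (U x)
open _∈_

_∉_ : Fin N → Sub N → Set
x ∉ U = ¬ x ∈ U

_⊆_ : Sub N → Sub N → Set
U ⊆ W = ∀ {x} → x ∈ U → x ∈ W

_∈?_ : ∀ (x : Fin N) U → Dec (x ∈ U)
x ∈? U with U x in eq
... | true  = yes ⟨ subst T (sym eq) tt ⟩
... | false = no λ p → subst T eq (holds p)

infixl 7 _∩_
infixl 6 _∪_ _∖_

opaque
  _∩_ _∪_ _∖_ : Sub N → Sub N → Sub N
  (U ∩ W) x = U x ∧ W x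
  (U ∪ W) x = U x ∨ W x
  (U ∖ W) x = U x ∧ not (W x)

  ∅ full : Sub N
  ∅ _    = false
  full _ = true

  ⁅_⁆ : Fin N → Sub N
  ⁅ x ⁆ y = ⌊ x ≟ y ⌋

  ⟦_⟧ : ∀ {P : Fin N → Set} → (∀ x → Dec (P x)) → Sub N
  ⟦ P? ⟧ x = ⌊ P? x ⌋

  ∈∅ : ∀ {x : Fin N} → x ∉ ∅
  ∈∅ ()

  ∈full : ∀ {x : Fin N} → x ∈ full
  ∈full = ⟨ tt ⟩

  ∩-i : ∀ {x : Fin N} {U W} → x ∈ U → x ∈ W → x ∈ U ∩ W
  ∩-i p q = ⟨ Equivalence.from T-∧ (holds p , holds q) ⟩

  ∩-l : ∀ {x : Fin N} {U W} → x ∈ U ∩ W → x ∈ U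
  ∩-l p = ⟨ proj₁ (Equivalence.to T-∧ (holds p)) ⟩

  ∩-r : ∀ {x : Fin N} {U W} → x ∈ U ∩ W → x ∈ W
  ∩-r {U = U} p = ⟨ proj₂ (Equivalence.to (T-∧ {U _}) (holds p)) ⟩

  ∪-l : ∀ {x : Fin N} {U W} → x ∈ U → x ∈ U ∪ W
  ∪-l p = ⟨ Equivalence.from T-∨ (inj₁ (holds p)) ⟩

  ∪-r : ∀ {x : Fin N} {U W} → x ∈ W → x ∈ U ∪ W
  ∪-r {x = x} {U} p = ⟨ Equivalence.from (T-∨ {U x}) (inj₂ (holds p)) ⟩

  ∪-e : ∀ {x : Fin N} {U W} → x ∈ U ∪ W → x ∈ U ⊎ x ∈ W
  ∪-e {x = x} {U} p with Equivalence.to (T-∨ {U x}) (holds p)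
  ... | inj₁ q = inj₁ ⟨ q ⟩
  ... | inj₂ q = inj₂ ⟨ q ⟩

  ∖-i : ∀ {x : Fin N} {U W} → x ∈ U → x ∉ W → x ∈ U ∖ W
  ∖-i {x = x} {U} {W} p q with W x in eq
  ... | true  = ⊥-elim (q ⟨ subst T (sym eq) tt ⟩)
  ... | false = ⟨ Equivalence.from T-∧ (holds p , subst (T ∘ not) (sym eq) tt) ⟩

  ∖-l : ∀ {x : Fin N} {U W} → x ∈ U ∖ W → x ∈ U
  ∖-l p = ⟨ proj₁ (Equivalence.to T-∧ (holds p)) ⟩

  ∖-r : ∀ {x : Fin N} {U W} → x ∈ U ∖ W → x ∉ W
  ∖-r {x = x} {U} {W} p q with W x | proj₂ (Equivalence.to (T-∧ {U x}) (holds p)) | holds q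
  ... | true | () | _

  ⁅⁆-i : ∀ {x : Fin N} → x ∈ ⁅ x ⁆
  ⁅⁆-i {x = x} = ⟨ fromWitness refl ⟩

  ⁅⁆-e : ∀ {x y : Fin N} → y ∈ ⁅ x ⁆ → x ≡ y
  ⁅⁆-e p = toWitness (holds p)

  ⟦⟧-i : ∀ {P : Fin N → Set} {P? : ∀ x → Dec (P x)} {x} → P x → x ∈ ⟦ P? ⟧
  ⟦⟧-i p = ⟨ fromWitness p ⟩

  ⟦⟧-e : ∀ {P : Fin N → Set} {P? : ∀ x → Dec (P x)} {x} → x ∈ ⟦ P? ⟧ → P x
  ⟦⟧-e p = toWitness (holds p)

opaque
  unfolding ∑

  ∑-bound : ∀ {f : Fin N → ℕ} {m} → (∀ x → f x ≤ m) → ∑ f ≤ N * m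
  ∑-bound {zero}  h = z≤n
  ∑-bound {suc N} h = +-mono-≤ (h zero) (∑-bound (h ∘ suc))

  ∑-term : ∀ (f : Fin N → ℕ) x → f x ≤ ∑ f
  ∑-term f zero    = m≤m+n _ _
  ∑-term f (suc x) = ≤-trans (∑-term (f ∘ suc) x) (m≤n+m _ _)

  ∑-mono-< : ∀ {f g : Fin N → ℕ} → (∀ x → f x ≤ g x) → ∀ x → f x < g x → ∑ f < ∑ g
  ∑-mono-< h zero    p = +-mono-≤ p (∑-mono (h ∘ suc))
  ∑-mono-< {suc N} {f} h (suc x) p =
    ≤-trans (≤-reflexive (sym (+-suc (f zero) _))) (+-mono-≤ (h zero) (∑-mono-< (h ∘ suc) x p))

opaque
  ∥_∥ : Sub N → ℕ
  ∥ U ∥ = ∑ (𝟙 ∘ U)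

  ∥∥-∑ : ∀ (U : Sub N) → ∥ U ∥ ≡ ∑ (𝟙 ∘ U)
  ∥∥-∑ U = refl

𝟙≤1 : ∀ b → 𝟙 b ≤ 1
𝟙≤1 true  = ≤-refl
𝟙≤1 false = z≤n

𝟙-∈ : ∀ {x : Fin N} {U} → x ∈ U → 𝟙 (U x) ≡ 1
𝟙-∈ {x = x} {U} p with U x | holds p
... | true | _ = refl

𝟙-bound : ∀ {x : Fin N} {U m} → (x ∈ U → 1 ≤ m) → 𝟙 (U x) ≤ m
𝟙-bound {x = x} {U} h with U x in eq
... | true  = h ⟨ subst T (sym eq) tt ⟩
... | false = z≤n

opaque
  unfolding ∥_∥

  ∥∥-cover : ∀ {U W Z : Sub N} → (∀ {x} → x ∈ U → x ∈ W ⊎ x ∈ Z) → ∥ U ∥ ≤ ∥ W ∥ + ∥ Z ∥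
  ∥∥-cover {U = U} {W} {Z} h = ≤-trans (∑-mono pointwise) (≤-reflexive (∑-+ _ _))
    where
    pointwise : ∀ x → 𝟙 (U x) ≤ 𝟙 (W x) + 𝟙 (Z x)
    pointwise x = 𝟙-bound {x = x} {U} λ p → case h p of λ where
      (inj₁ q) → ≤-trans (≤-reflexive (sym (𝟙-∈ q))) (m≤m+n _ _)
      (inj₂ q) → ≤-trans (≤-reflexive (sym (𝟙-∈ q))) (m≤n+m _ _)

  ∥∥-disjoint : ∀ {U W Z : Sub N} → W ⊆ U → Z ⊆ U → (∀ {x} → x ∈ W → x ∈ Z → ⊥) →
                ∥ W ∥ + ∥ Z ∥ ≤ ∥ U ∥
  ∥∥-disjoint {U = U} {W} {Z} i j d = ≤-trans (≤-reflexive (sym (∑-+ _ _))) (∑-mono pointwise)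
    where
    pointwise : ∀ x → 𝟙 (W x) + 𝟙 (Z x) ≤ 𝟙 (U x)
    pointwise x with x ∈? W | x ∈? Z
    ... | yes p | yes q = ⊥-elim (d p q)
    ... | yes p | no q  = ≤-trans (+-mono-≤ (𝟙≤1 (W x)) (𝟙-bound {x = x} {Z} (⊥-elim ∘ q)))
                                  (≤-reflexive (sym (𝟙-∈ (i p))))
    ... | no p  | _     = ≤-trans (+-mono-≤ (𝟙-bound {x = x} {W} (⊥-elim ∘ p)) ≤-refl)
                                  (𝟙-bound {x = x} {Z} λ q → ≤-reflexive (sym (𝟙-∈ (j q))))

opaque
  unfolding ∥_∥ ∅

  ∥∅∥ : ∥ ∅ {N} ∥ ≡ 0
  ∥∅∥ {N} = ∑-zero {N}

∥∥-mono : ∀ {U W : Sub N} → U ⊆ W → ∥ U ∥ ≤ ∥ W ∥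
∥∥-mono {N} {U} {W} h = ≤-trans (∥∥-cover {Z = ∅} (inj₁ ∘ h))
                          (≤-reflexive (trans (cong (∥ W ∥ +_) (∥∅∥ {N})) (+-identityʳ _)))

∥∪∥ : ∀ (U W : Sub N) → ∥ U ∪ W ∥ ≤ ∥ U ∥ + ∥ W ∥
∥∪∥ U W = ∥∥-cover ∪-e

∥∖∥ : ∀ (U W : Sub N) → ∥ U ∥ ≤ ∥ U ∖ W ∥ + ∥ W ∥
∥∖∥ U W = ∥∥-cover λ {x} p → case x ∈? W of λ where
  (yes q) → inj₂ q
  (no q)  → inj₁ (∖-i p q)

opaque
  unfolding ∥_∥ ∑

  inhabited : ∀ {U : Sub N} → 0 < ∥ U ∥ → ∃ λ x → x ∈ U
  inhabited {suc N} {U} p with zero ∈? U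
  ... | yes q = zero , q
  ... | no q  with inhabited {N} {U ∘ suc} (≤-trans p (+-monoˡ-≤ _ (𝟙-bound {x = zero} {U} (⊥-elim ∘ q))))
  ...   | x , r = suc x , ⟨ holds r ⟩

opaque
  unfolding ∑ ⁅_⁆

  ∑-point : ∀ (x : Fin N) (g : Fin N → ℕ) → ∑ (λ y → 𝟙 (⁅ x ⁆ y) * g y) ≡ g x
  ∑-point {suc N} zero    g =
    trans (cong₂ _+_ (+-identityʳ (g zero)) (∑-zero {N})) (+-identityʳ (g zero))
  ∑-point {suc N} (suc x) g = trans (∑-cong shift) (∑-point x (g ∘ suc))
    where
    shift : ∀ y → 𝟙 (⁅ suc x ⁆ (suc y)) * g (suc y) ≡ 𝟙 (⁅ x ⁆ y) * g (suc y)
    shift y with x ≟ y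
    ... | yes _ = refl
    ... | no _  = refl

opaque
  unfolding ∥_∥

  ∥⁅⁆∥ : ∀ (x : Fin N) → ∥ ⁅ x ⁆ ∥ ≡ 1
  ∥⁅⁆∥ x = trans (∑-cong λ y → sym (trans (*-comm (𝟙 (⁅ x ⁆ y)) 1) (+-identityʳ _))) (∑-point x (const 1))

∥∥-inhabited : ∀ {x : Fin N} {U} → x ∈ U → 0 < ∥ U ∥
∥∥-inhabited {x = x} {U} p =
  ≤-trans (≤-reflexive (sym (∥⁅⁆∥ x))) (∥∥-mono λ q → subst (_∈ U) (⁅⁆-e q) p)

∥∖∥-fresh : ∀ (U Y : Sub N) → ∥ Y ∥ < ∥ U ∥ → ∃ λ x → x ∈ U ∖ Y
∥∖∥-fresh U Y p = inhabited (+-cancelʳ-≤ ∥ Y ∥ _ _ (≤-trans p (∥∖∥ U Y)))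

opaque
  unfolding ∑ ∥_∥ full

  ∥full∥ : ∥ full {N} ∥ ≡ N
  ∥full∥ {zero}  = refl
  ∥full∥ {suc N} = cong suc (∥full∥ {N})

-- Trees and their embeddings

Relation : ℕ → Set
Relation N = Fin N → Sub N

flip : Relation N → Relation N
flip R x y = R y x

flip-i : ∀ {R : Relation N} {x y} → y ∈ R x → x ∈ flip R y
flip-i p = ⟨ _∈_.holds p ⟩

data Dir : Set where
  fwd bwd : Dir

opp : Dir → Dir
opp fwd = bwd
opp bwd = fwd

along : Relation N → Dir → Relation N
along R fwd = R
along R bwd = flip R

infixl 5 _◂[_]_
-- `t ◂[ s ] u` hangs `u` from the root of `t`; for `fwd` the edge points to `u`. Compared with
-- lists of children, every induction has a single subtree to split off, and the root remains that
-- of `t`.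
data Tree : Set where
  •      : Tree
  _◂[_]_ : Tree → Dir → Tree → Tree

size : Tree → ℕ
size •            = 1
size (t ◂[ _ ] u) = size t + size u

0<size : ∀ t → 0 < size t
0<size •            = s≤s z≤n
0<size (t ◂[ _ ] u) = ≤-trans (0<size t) (m≤m+n _ _)

module _ (A : Dir → Relation N) where

  -- The relation depends on the direction so that one definition serves both oriented trees
  -- (`along R`) and arborescences (`arb R`).
  data Emb : Tree → Fin N → Sub N → Set where
    point : ∀ {x} → Emb • x ⁅ x ⁆
    graft : ∀ {t s u x y X Y} → Emb t x X → Emb u y Y → (∀ {z} → z ∈ X → z ∈ Y → ⊥) →
            y ∈ A s x → Emb (t ◂[ s ] u) x (X ∪ Y)

  Has : Tree → Sub N → Set
  Has t U = ∃ λ x → ∃ λ X → X ⊆ U × Emb t x X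

  Has-mono : ∀ {t U W} → U ⊆ W → Has t U → Has t W
  Has-mono i (x , X , j , e) = x , X , i ∘ j , e

module _ {A : Dir → Relation N} where

  Emb-root : ∀ {t x X} → Emb A t x X → x ∈ X
  Emb-root point           = ⁅⁆-i
  Emb-root (graft e _ _ _) = ∪-l (Emb-root e)

  Emb-size : ∀ {t x X} → Emb A t x X → ∥ X ∥ ≤ size t
  Emb-size (point {x})       = ≤-reflexive (∥⁅⁆∥ x)
  Emb-size (graft e f _ _) = ≤-trans (∥∪∥ _ _) (+-mono-≤ (Emb-size e) (Emb-size f))

  -- `Y` holds everything used so far. As `Y` and the tree together have at most `n` elements,
  -- degree `n` always leaves a neighbour that is still free.
  greedy : ∀ {V n} → (∀ {x} → x ∈ V → ∀ s → n ≤ ∥ A s x ∩ V ∥) →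
           ∀ t {x} Y → x ∈ V → x ∉ Y → ∥ Y ∥ + size t ≤ n →
           ∃ λ X → X ⊆ V × Emb A t x X × (∀ {z} → z ∈ X → z ∈ Y → ⊥)
  greedy deg • {x} Y x∈V x∉Y _ =
    ⁅ x ⁆ , (λ p → subst (_∈ _) (⁅⁆-e p) x∈V) , point , λ p q → x∉Y (subst (_∈ Y) (sym (⁅⁆-e p)) q)
  greedy {V} {n} deg (t ◂[ s ] u) {x} Y x∈V x∉Y b =
    let bt = ≤-trans (+-monoʳ-≤ ∥ Y ∥ (m≤m+n (size t) (size u))) b
        X , X⊆V , e , X∥Y = greedy deg t Y x∈V x∉Y bt
        cY = ≤-trans (∥∪∥ Y X) (+-monoʳ-≤ ∥ Y ∥ (Emb-size e))
        b′ = ≤-trans (≤-reflexive (+-assoc ∥ Y ∥ (size t) (size u))) b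
        fresh = <-≤-trans (m<m+n (∥ Y ∥ + size t) (0<size u)) b′
        y , y∈ = ∥∖∥-fresh (A s x ∩ V) (Y ∪ X) (<-≤-trans (≤-<-trans cY fresh) (deg x∈V s))
        Z , Z⊆V , f , Z∥ = greedy deg u (Y ∪ X) (∩-r (∖-l y∈)) (∖-r y∈)
                              (≤-trans (+-monoˡ-≤ (size u) cY) b′)
    in X ∪ Z
     , (λ p → [ X⊆V , Z⊆V ]′ (∪-e p))
     , graft e f (λ p q → Z∥ q (∪-r p)) (∩-l (∖-l y∈))
     , (λ p q → [ (λ r → X∥Y r q) , (λ r → Z∥ r (∪-l q)) ]′ (∪-e p))

-- An arborescence along R: the directions stored in the tree are ignored.
arb : Relation N → Dir → Relation N
arb R _ = R

-- Removes a leaf, which can be put back in any set S that dominates all possible images of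
-- its neighbour.
strip : ∀ t → t ≡ • ⊎ ∃ λ t′ → size t ≡ suc (size t′) ×
        (∀ {N} {R : Relation N} {V S : Sub N} → (∀ {v} → v ∈ V → ∃ λ q → q ∈ S × q ∈ R v) →
         (∀ {v} → v ∈ V → v ∈ S → ⊥) → ∀ {x X} → X ⊆ V → Emb (arb R) t′ x X →
         ∃ λ X′ → Emb (arb R) t x X′ × X′ ⊆ X ∪ S)
strip •            = inj₁ refl
strip (t ◂[ s ] •) = inj₂ (t , +-comm (size t) 1 , λ dom disj {x} {X} X⊆V e →
  let q , q∈S , r = dom (X⊆V (Emb-root e)) in
  X ∪ ⁅ q ⁆
  , graft e point (λ p p′ → disj (X⊆V p) (subst (_∈ _) (⁅⁆-e p′) q∈S)) r
  , λ p → [ ∪-l , (λ p′ → ∪-r (subst (_∈ _) (⁅⁆-e p′) q∈S)) ]′ (∪-e p))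
strip (t ◂[ s ] u@(_ ◂[ _ ] _)) with strip u
... | inj₂ (u′ , eq , restore) =
  inj₂ (t ◂[ s ] u′ , trans (cong (size t +_) eq) (+-suc (size t) (size u′)) , ext)
  where
  ext : ∀ {N} {R : Relation N} {V S : Sub N} → (∀ {v} → v ∈ V → ∃ λ q → q ∈ S × q ∈ R v) →
        (∀ {v} → v ∈ V → v ∈ S → ⊥) → ∀ {x X} → X ⊆ V → Emb (arb R) (t ◂[ s ] u′) x X →
        ∃ λ X′ → Emb (arb R) (t ◂[ s ] u) x X′ × X′ ⊆ X ∪ S
  ext dom disj X⊆V (graft {X = X} {Y} e f d r) =
    let Y′ , f′ , Y′⊆ = restore dom disj (X⊆V ∘ ∪-r) f in
    X ∪ Y′
    , graft e f′ (λ p q → [ d p , disj (X⊆V (∪-l p)) ]′ (∪-e (Y′⊆ q))) r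
    , λ p → [ ∪-l ∘ ∪-l , (λ q → [ ∪-l ∘ ∪-r , ∪-r ]′ (∪-e (Y′⊆ q))) ]′ (∪-e p)

-- Directed paths

elems : List (Fin N) → Sub N
elems []      = ∅
elems (x ∷ p) = ⁅ x ⁆ ∪ elems p

∥elems∥ : ∀ (p : List (Fin N)) → ∥ elems p ∥ ≤ length p
∥elems∥ {N} []  = ≤-reflexive (∥∅∥ {N})
∥elems∥ (x ∷ p) = ≤-trans (∥∪∥ _ _) (+-mono-≤ (≤-reflexive (∥⁅⁆∥ x)) (∥elems∥ p))

data Path (R : Relation N) : Fin N → List (Fin N) → Set where
  end  : ∀ {x} → Path R x []
  step : ∀ {x y p} → y ∈ R x → x ∉ elems (y ∷ p) → Path R y p → Path R x (y ∷ p)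

HasPath : Relation N → Sub N → ℕ → Set
HasPath R U n = ∃ λ x → ∃ λ p → elems (x ∷ p) ⊆ U × Path R x p × suc (length p) ≡ n

insert-⊆ : ∀ {U W : Sub N} {x} → x ∈ U → W ⊆ U → ⁅ x ⁆ ∪ W ⊆ U
insert-⊆ {U = U} x∈U p⊆U q = [ (λ r → subst (_∈ U) (⁅⁆-e r) x∈U) , p⊆U ]′ (∪-e q)

truncate : ∀ {R : Relation N} n {x p} → Path R x p → n ≤ length p →
           ∃ λ p′ → Path R x p′ × length p′ ≡ n × elems (x ∷ p′) ⊆ elems (x ∷ p)
truncate zero w _ = [] , end , refl , insert-⊆ (∪-l ⁅⁆-i) (⊥-elim ∘ ∈∅)
truncate (suc n) (step r x∉ w) (s≤s le) =
  let p′ , w′ , eq , j = truncate n w le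
  in _ , step r (x∉ ∘ j) w′ , cong suc eq , insert-⊆ (∪-l ⁅⁆-i) (∪-r ∘ j)

reverse : ∀ {R : Relation N} {U n} → HasPath R U n → HasPath (flip R) U n
reverse {R = R} {U} {n} (x , p , i , w , eq) =
  go w [] (i (∪-l ⁅⁆-i)) end (i ∘ ∪-r) (⊥-elim ∘ ∈∅) (avoid w) (trans (+-comm (suc (length p)) 0) eq)
  where
  avoid : ∀ {x p} → Path R x p → ∀ {z} → z ∈ elems p → z ∈ elems (x ∷ []) → ⊥
  avoid end q _ = ∈∅ q
  avoid (step r x∉ w) q q′ = [ (λ e → x∉ (subst (_∈ _) (sym (⁅⁆-e e)) q)) , ∈∅ ]′ (∪-e q′)
  go : ∀ {x p} → Path R x p → ∀ acc → x ∈ U → Path (flip R) x acc → elems p ⊆ U → elems acc ⊆ U →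
       (∀ {z} → z ∈ elems p → z ∈ elems (x ∷ acc) → ⊥) → suc (length p) + length acc ≡ n →
       HasPath (flip R) U n
  go end acc x∈ w′ i i′ d eq = _ , acc , insert-⊆ x∈ i′ , w′ , eq
  go {x} (step {y = y} {p} r x∉ w) acc x∈ w′ i i′ d eq =
    go w (x ∷ acc) (i (∪-l ⁅⁆-i)) (step (flip-i r) (λ q → d (∪-l ⁅⁆-i) q) w′) (i ∘ ∪-r)
       (insert-⊆ x∈ i′)
       (λ {z} q q′ → [ (λ e → avoid w q (subst (_∈ _) (⁅⁆-e e) (∪-l ⁅⁆-i)))
                     , d (∪-r q) ]′ (∪-e q′))
       (trans (+-suc (suc (length p)) (length acc)) eq)

-- The Gallai–Roy theorem, in a strong form

module Levels (R : Relation N) (W : Sub N) where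

  Supported : (Fin N → ℕ) → Set
  Supported ℓ = ∀ {v t} → v ∈ W → ℓ v ≡ suc t → ∃ λ u → u ∈ W × v ∈ R u × ℓ u ≡ t

  module _ (ℓ : Fin N → ℕ) where

    Dom : Fin N → ℕ → Fin N → Set
    Dom s zero    u = s ≡ u
    Dom s (suc j) u = ∀ p → p ∈ W → u ∈ R p → ℓ p ≡ j + ℓ s → Dom s j p

    -- Every sequence of predecessors that descends from u level by level passes through s.
    Below : Fin N → Fin N → Set
    Below s u = u ∈ W × ∃ λ j → ℓ u ≡ j + ℓ s × Dom s j u

    dom? : ∀ s j u → Dec (Dom s j u)
    dom? s zero    u = s ≟ u
    dom? s (suc j) u =
      all? λ p → (p ∈? W) →-dec ((u ∈? R p) →-dec ((ℓ p ℕ.≟ j + ℓ s) →-dec dom? s j p))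

    below? : ∀ s u → Dec (Below s u)
    below? s u with u ∈? W | ℓ s ≤? ℓ u
    ... | no q  | _      = no (q ∘ proj₁)
    ... | yes _ | no q   = no λ (_ , j , eq , _) → q (≤-trans (m≤n+m (ℓ s) j) (≤-reflexive (sym eq)))
    ... | yes p | yes le =
      map′ (λ d → p , ℓ u ∸ ℓ s , sym (m∸n+n≡m le) , d)
           (λ (_ , j , eq , d) → subst (λ i → Dom s i u) (trans (sym (m+n∸n≡m j (ℓ s))) (cong (_∸ ℓ s) (sym eq))) d)
           (dom? s (ℓ u ∸ ℓ s) u)

    -- No move of the kind made in `Raise` is left: an edge that does not go up leads to a vertex
    -- through which all descending sequences from its tail pass. The usual Gallai-Roy theorem only
    -- asks that levels be independent.
    Stable : Set
    Stable = ∀ {w s} → w ∈ W → s ∈ W → s ∈ R w → ℓ s ≤ ℓ w → Below s w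

    module _ (supp : Supported ℓ) (stable : Stable) where

      same-level : ∀ {w s} → w ∈ W → s ∈ W → s ∈ R w → ℓ s ≡ ℓ w → s ≡ w
      same-level {w} {s} p q r eq with stable p q r (≤-reflexive eq)
      ... | _ , zero  , _   , d = d
      ... | _ , suc j , eq′ , _ = ⊥-elim (m≢1+n+m (ℓ s) (trans eq eq′))

      -- Support yields a descending sequence from `u` to the level in question, and its last vertex
      -- is both `s` and `s′`.
      unique-dominator : ∀ j {s s′ u} → u ∈ W → ℓ s ≡ ℓ s′ → ℓ u ≡ j + ℓ s → Dom s j u → Dom s′ j u → s ≡ s′
      unique-dominator zero    _  _  _  d d′ = trans d (sym d′)
      unique-dominator (suc j) u∈ eq eu d d′ =
        let p , p∈ , r , ep = supp u∈ eu
        in unique-dominator j p∈ eq ep (d p p∈ r ep) (d′ p p∈ r (trans ep (cong (j +_) eq)))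

      one-per-level : ∀ {w s s′} → w ∈ W → s ∈ W → s′ ∈ W → ℓ s ≡ ℓ s′ → ℓ s ≤ ℓ w →
                      s ∈ R w → s′ ∈ R w → s ≡ s′
      one-per-level {w} {s} {s′} w∈ s∈ s′∈ eq le r r′
        with stable w∈ s∈ r le | stable w∈ s′∈ r′ (subst (_≤ ℓ w) eq le)
      ... | _ , j , e , d | _ , j′ , e′ , d′ =
        unique-dominator j w∈ eq e d (subst (λ i → Dom s′ i w) (sym j≡j′) d′)
        where
        j≡j′ : j ≡ j′
        j≡j′ = +-cancelʳ-≡ (ℓ s) j j′ (trans (sym e) (trans e′ (cong (j′ +_) (sym eq))))

    -- s moves just above w, and everything below s moves along; w itself stays, as it is not below s.
    module Raise (supp : Supported ℓ) {w s} (w∈ : w ∈ W) (s∈ : s ∈ W) (r : s ∈ R w) (le : ℓ s ≤ ℓ w)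
                 (w∌ : ¬ Below s w) where

      δ : ℕ
      δ = suc (ℓ w) ∸ ℓ s

      raised : Fin N → ℕ
      raised u with below? s u
      ... | yes _ = ℓ u + δ
      ... | no _  = ℓ u

      raised-yes : ∀ {u} → Below s u → raised u ≡ ℓ u + δ
      raised-yes {u} b with below? s u
      ... | yes _ = refl
      ... | no q  = ⊥-elim (q b)

      raised-no : ∀ {u} → ¬ Below s u → raised u ≡ ℓ u
      raised-no {u} b with below? s u
      ... | yes q = ⊥-elim (b q)
      ... | no _  = refl

      raised-s : raised s ≡ suc (ℓ w)
      raised-s = trans (raised-yes (s∈ , 0 , refl , refl)) (m+[n∸m]≡n (≤-trans le (n≤1+n _)))

      raised-≥ : ∀ u → ℓ u ≤ raised u
      raised-≥ u with below? s u
      ... | yes _ = m≤m+n (ℓ u) δ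
      ... | no _  = ≤-refl

      ∑-grows : ∑ ℓ < ∑ raised
      ∑-grows = ∑-mono-< raised-≥ s (≤-trans (s≤s le) (≤-reflexive (sym raised-s)))

      -- The vertex `s` is now supported by `w`, and a vertex strictly below `s` by a predecessor
      -- that moved along. A vertex that stays has a supporting predecessor that stays: if all its
      -- predecessors one level down were below `s`, so would be the vertex itself.
      raised-supp : Supported raised
      raised-supp {v} {t} v∈ eq with below? s v
      ... | yes (_ , zero , _ , refl) =
        w , w∈ , r , trans (raised-no w∌) (suc-injective (trans (sym (m+[n∸m]≡n (≤-trans le (n≤1+n _)))) eq))
      ... | yes (_ , suc j , e , d) =
        let p , p∈ , r′ , ep = supp v∈ e
        in p , p∈ , r′ , trans (raised-yes (p∈ , j , ep , d p p∈ r′ ep))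
                            (trans (cong (_+ δ) ep) (suc-injective (trans (cong (_+ δ) (sym e)) eq)))
      ... | no v∉ with any? (λ p → (p ∈? W) ×-dec ((v ∈? R p) ×-dec ((ℓ p ℕ.≟ t) ×-dec ¬? (below? s p))))
      ...   | yes (p , p∈ , r′ , ep , p∌) = p , p∈ , r′ , trans (raised-no p∌) ep
      ...   | no none with supp v∈ eq
      ...     | p , p∈ , r′ , ep with below? s p
      ...       | no p∌ = ⊥-elim (none (p , p∈ , r′ , ep , p∌))
      ...       | yes (_ , j , ej , _) = ⊥-elim (v∉ (v∈ , suc j , trans eq (cong suc t≡) , all-below))
        where
        t≡ : t ≡ j + ℓ s
        t≡ = trans (sym ep) ej
        all-below : Dom s (suc j) v
        all-below p′ p′∈ r″ e′ with below? s p′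
        ... | no p′∌ = ⊥-elim (none (p′ , p′∈ , r″ , trans e′ (sym t≡) , p′∌))
        ... | yes (_ , i , ei , d) = subst (λ i → Dom s i p′) (+-cancelʳ-≡ (ℓ s) i j (trans (sym ei) e′)) d

  -- Levels strictly decrease along the sequence, so its vertices are distinct, and level `t` yields
  -- a path on `t + 1` vertices.
  descend : ∀ {ℓ} → Supported ℓ → ∀ t {v} → v ∈ W → ℓ v ≡ t →
            ∃ λ p → Path (flip R) v p × elems (v ∷ p) ⊆ W × length p ≡ t × (∀ {z} → z ∈ elems (v ∷ p) → ℓ z ≤ t)
  descend {ℓ} supp zero v∈ eq =
    [] , end , insert-⊆ v∈ (⊥-elim ∘ ∈∅) , refl ,
    λ q → [ (λ e → subst (λ z → ℓ z ≤ 0) (⁅⁆-e e) (≤-reflexive eq)) , ⊥-elim ∘ ∈∅ ]′ (∪-e q)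
  descend {ℓ} supp (suc t) {v} v∈ eq =
    let u , u∈ , r , eu = supp v∈ eq
        p , w , i , len , low = descend supp t u∈ eu
    in u ∷ p , step (flip-i {R = R} r) (λ q → 1+n≰n (≤-trans (≤-reflexive (sym eq)) (low q))) w , insert-⊆ v∈ i , cong suc len ,
       λ q → [ (λ e → subst (λ z → ℓ z ≤ suc t) (⁅⁆-e e) (≤-reflexive eq)) , (λ q → ≤-trans (low q) (n≤1+n t)) ]′ (∪-e q)

  module _ {m} (pathless : ¬ HasPath (flip R) W (suc m)) where

    level< : ∀ {ℓ} → Supported ℓ → ∀ {v} → v ∈ W → ℓ v < m
    level< {ℓ} supp {v} v∈ = ≰⇒> λ m≤ →
      let p , w , i , len , _ = descend supp (ℓ v) v∈ refl
          p′ , w′ , len′ , j = truncate m w (≤-trans m≤ (≤-reflexive (sym len)))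
      in pathless (v , p′ , i ∘ j , w′ , cong suc len′)

    -- Each raise increases `∑ ℓ`. Levels stay below `m` in `W` and are 0 outside, so at most
    -- `N * m` raises are possible.
    gallai-roy : ∃ λ ℓ → Supported ℓ × Stable ℓ
    gallai-roy = search (suc (N * m)) (const 0) (λ _ ()) (λ _ → refl) (m≤n+m _ (∑ (const 0)))
      where
      search : ∀ fuel ℓ → Supported ℓ → (∀ {x} → x ∉ W → ℓ x ≡ 0) → suc (N * m) ≤ ∑ ℓ + fuel →
               ∃ λ ℓ → Supported ℓ × Stable ℓ
      search zero ℓ supp off b =
        ⊥-elim (1+n≰n (≤-trans b (≤-trans (≤-reflexive (+-identityʳ (∑ ℓ))) (∑-bound small))))
        where
        small : ∀ x → ℓ x ≤ m
        small x with x ∈? W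
        ... | yes p = <⇒≤ (level< supp p)
        ... | no p  = ≤-trans (≤-reflexive (off p)) z≤n
      search (suc fuel) ℓ supp off b with any? (λ w → any? λ s →
        (w ∈? W) ×-dec ((s ∈? W) ×-dec ((s ∈? R w) ×-dec ((ℓ s ≤? ℓ w) ×-dec ¬? (below? ℓ s w)))))
      ... | yes (w , s , w∈ , s∈ , r , le , w∌) =
        search fuel raised raised-supp (λ x∉ → trans (raised-no (x∉ ∘ proj₁)) (off x∉))
               (≤-trans b (≤-trans (≤-reflexive (+-suc (∑ ℓ) fuel)) (+-monoˡ-≤ fuel ∑-grows)))
        where open Raise ℓ supp w∈ s∈ r le w∌
      ... | no none = ℓ , supp , λ {w} {s} w∈ s∈ r le → case below? ℓ s w of λ where
        (yes b) → b
        (no w∌) → ⊥-elim (none (w , s , w∈ , s∈ , r , le , w∌))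

two-elements : ∀ {U : Sub N} → 2 ≤ ∥ U ∥ → ∃ λ x → ∃ λ y → x ∈ U × y ∈ U × x ≢ y
two-elements {U = U} le =
  let x , x∈ = inhabited (≤-trans (s≤s z≤n) le)
      y , y∈ = ∥∖∥-fresh U ⁅ x ⁆ (<-≤-trans (s≤s (≤-reflexive (∥⁅⁆∥ x))) le)
  in x , y , x∈ , ∖-l y∈ , λ eq → ∖-r y∈ (subst (_∈ ⁅ x ⁆) eq ⁅⁆-i)

-- Two vertices s, s′ of the lowest level absorb all others: by one-per-level, no vertex has
-- R-edges to both, hence it has a D-edge to one of them.
module _ {R D : Relation N} {W : Sub N}
         (cover : ∀ {x y} → x ∈ W → y ∈ W → x ≢ y → y ∈ R x ⊎ y ∈ D x) where
  open Levels R W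

  module _ {m} (ℓ : Fin N → ℕ) (supp : Supported ℓ) (stable : Stable ℓ) (low : ∀ {v} → v ∈ W → ℓ v < m) where

    -- The summand `r` pays for the remaining levels, each of which is discarded at the cost of at
    -- most one vertex. The summand `2 * k` pays for the two absorbing vertices reserved when a leaf
    -- is stripped, only one of which receives the leaf.
    levelwise : ∀ r l → l + r ≡ m → ∀ k t → size t ≡ k → ∀ {V} → V ⊆ W →
                (∀ {v} → v ∈ V → l ≤ ℓ v) → r + 2 * k ≤ ∥ V ∥ → Has (arb D) t V
    levelwise zero l eq k t refl V⊆W above big =
      let v , v∈ = inhabited (≤-trans (≤-trans (0<size t) (m≤m+n _ _)) big)
      in ⊥-elim (<⇒≱ (low (V⊆W v∈)) (≤-trans (≤-reflexive (trans (sym eq) (+-identityʳ l))) (above v∈)))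
    levelwise (suc r) l eq k t sz {V} V⊆W above big with 2 ≤? ∥ ⟦ (λ x → (x ∈? V) ×-dec (ℓ x ℕ.≟ l)) ⟧ ∥
    levelwise (suc r) l eq k t sz {V} V⊆W above big | no few =
      Has-mono (arb D) ∖-l
        (levelwise r (suc l) (trans (sym (+-suc l r)) eq) k t sz (V⊆W ∘ ∖-l)
          (λ q → ≤∧≢⇒< (above (∖-l q)) λ e → ∖-r q (⟦⟧-i (∖-l q , sym e)))
          (+-cancelʳ-≤ 1 _ _ (≤-trans (≤-reflexive (+-comm _ 1))
            (≤-trans big (≤-trans (∥∖∥ V _) (+-monoʳ-≤ _ (s≤s⁻¹ (≰⇒> few))))))))
    levelwise (suc r) l eq k t sz {V} V⊆W above big | yes many with strip t
    ... | inj₁ refl =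
      let v , v∈ = inhabited (≤-trans (s≤s z≤n) big)
      in v , ⁅ v ⁆ , (λ q → subst (_∈ V) (⁅⁆-e q) v∈) , point
    levelwise (suc r) l eq zero t sz V⊆W above big | yes many | inj₂ (t′ , sz′ , _) with trans (sym sz) sz′
    ... | ()
    levelwise (suc r) l eq (suc k) t sz {V} V⊆W above big | yes many | inj₂ (t′ , sz′ , restore) =
      let s , s′ , s∈ , s′∈ , s≢s′ = two-elements many
          sV , sl = ⟦⟧-e s∈
          s′V , s′l = ⟦⟧-e s′∈
          S = ⁅ s ⁆ ∪ ⁅ s′ ⁆
          V′ = V ∖ S
          ∥S∥ = ≤-trans (∥∪∥ ⁅ s ⁆ ⁅ s′ ⁆) (≤-reflexive (cong₂ _+_ (∥⁅⁆∥ s) (∥⁅⁆∥ s′)))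
          big′ = +-cancelʳ-≤ 2 _ _ (≤-trans (≤-reflexive (shift r k))
                   (≤-trans big (≤-trans (∥∖∥ V S) (+-monoʳ-≤ ∥ V′ ∥ ∥S∥))))
          absorb : ∀ {v} → v ∈ V′ → ∃ λ q → q ∈ S × q ∈ D v
          absorb {v} v∈ = case cover (V⊆W (∖-l v∈)) (V⊆W sV) (λ e → ∖-r v∈ (subst (_∈ S) (sym e) (∪-l ⁅⁆-i))) of λ where
            (inj₂ d) → s , ∪-l ⁅⁆-i , d
            (inj₁ r) → case cover (V⊆W (∖-l v∈)) (V⊆W s′V) (λ e → ∖-r v∈ (subst (_∈ S) (sym e) (∪-r ⁅⁆-i))) of λ where
              (inj₂ d) → s′ , ∪-r ⁅⁆-i , d
              (inj₁ r′) → ⊥-elim (s≢s′ (one-per-level ℓ supp stable (V⊆W (∖-l v∈)) (V⊆W sV) (V⊆W s′V)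
                (trans sl (sym s′l)) (≤-trans (≤-reflexive sl) (above (∖-l v∈))) r r′))
          x , X , X⊆ , e = levelwise (suc r) l eq k t′ (suc-injective (trans (sym sz′) sz)) {V′}
                             (V⊆W ∘ ∖-l) (above ∘ ∖-l) big′
          X′ , e′ , X′⊆ = restore absorb ∖-r X⊆ e
      in x , X′ , (λ q → [ ∖-l ∘ X⊆ , insert-⊆ sV (λ q → subst (_∈ V) (⁅⁆-e q) s′V) ]′ (∪-e (X′⊆ q))) , e′
      where
      shift : ∀ r k → suc r + 2 * k + 2 ≡ suc r + 2 * suc k
      shift = solve-∀

  arborescence-or-path : ∀ {m} → ¬ HasPath (flip R) W (suc m) → ∀ t → m + 2 * size t ≤ ∥ W ∥ → Has (arb D) t W
  arborescence-or-path {m} pathless t big =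
    let ℓ , supp , stable = gallai-roy pathless
    in levelwise ℓ supp stable (level< pathless supp) m 0 refl (size t) t refl id (λ _ → z≤n) big

-- Counting edges

opaque
  unfolding ∥_∥ _∩_ _∖_

  edges : Relation N → Sub N → Sub N → ℕ
  edges R X Y = ∑ λ x → 𝟙 (X x) * ∥ R x ∩ Y ∥

  edges-flip : ∀ (R : Relation N) X Y → edges R X Y ≡ edges (flip R) Y X
  edges-flip R X Y =
    trans (∑-cong λ x → sym (∑-* (𝟙 (X x)) (λ y → 𝟙 (R x y ∧ Y y))))
   (trans (∑-swap (λ x y → 𝟙 (X x) * 𝟙 (R x y ∧ Y y)))
          (∑-cong λ y → trans (∑-cong λ x → commute (X x) (R x y) (Y y))
                              (∑-* (𝟙 (Y y)) (λ x → 𝟙 (R x y ∧ X x)))))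
    where
    commute : ∀ a b c → 𝟙 a * 𝟙 (b ∧ c) ≡ 𝟙 c * 𝟙 (b ∧ a)
    commute false b     false = refl
    commute false false true  = refl
    commute false true  true  = refl
    commute true  false false = refl
    commute true  false true  = refl
    commute true  true  false = refl
    commute true  true  true  = refl

  edges-remove : ∀ (R : Relation N) X Y x → edges R X Y ≤ edges R (X ∖ ⁅ x ⁆) Y + ∥ R x ∩ Y ∥
  edges-remove {N} R X Y x = begin
    ∑ (λ z → 𝟙 (X z) * d z)                                              ≤⟨ ∑-mono pointwise ⟩
    ∑ (λ z → 𝟙 ((X ∖ ⁅ x ⁆) z) * d z + 𝟙 (⁅ x ⁆ z) * d z)                ≡⟨ ∑-+ _ _ ⟩
    ∑ (λ z → 𝟙 ((X ∖ ⁅ x ⁆) z) * d z) + ∑ (λ z → 𝟙 (⁅ x ⁆ z) * d z)      ≡⟨ cong (edges R (X ∖ ⁅ x ⁆) Y +_) (∑-point x d) ⟩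
    edges R (X ∖ ⁅ x ⁆) Y + d x                                          ∎
    where
    open ≤-Reasoning
    d : Fin N → ℕ
    d z = ∥ R z ∩ Y ∥
    split : ∀ a b → 𝟙 a ≤ 𝟙 (a ∧ not b) + 𝟙 b
    split true  true  = ≤-refl
    split true  false = ≤-refl
    split false _     = z≤n
    pointwise : ∀ z → 𝟙 (X z) * d z ≤ 𝟙 ((X ∖ ⁅ x ⁆) z) * d z + 𝟙 (⁅ x ⁆ z) * d z
    pointwise z = ≤-trans (*-monoˡ-≤ (d z) (split (X z) (⁅ x ⁆ z)))
                          (≤-reflexive (*-distribʳ-+ (d z) (𝟙 ((X ∖ ⁅ x ⁆) z)) _))

  edges-≥ : ∀ {R : Relation N} {X Y b} → (∀ {x} → x ∈ X → b ≤ ∥ R x ∩ Y ∥) → b * ∥ X ∥ ≤ edges R X Y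
  edges-≥ {R = R} {X} {Y} {b} h =
    ≤-trans (≤-reflexive (sym (∑-* b (𝟙 ∘ X)))) (∑-mono pointwise)
    where
    pointwise : ∀ x → b * 𝟙 (X x) ≤ 𝟙 (X x) * ∥ R x ∩ Y ∥
    pointwise x with x ∈? X
    ... | yes p = subst (λ i → b * i ≤ i * _) (sym (𝟙-∈ p))
                    (≤-trans (≤-reflexive (*-identityʳ b)) (≤-trans (h p) (≤-reflexive (sym (+-identityʳ _)))))
    ... | no p  = subst (λ i → b * i ≤ i * _) (sym (n≤0⇒n≡0 (𝟙-bound {x = x} {X} (⊥-elim ∘ p))))
                    (≤-reflexive (*-zeroʳ b))

  edges-≤ : ∀ {R : Relation N} {X Y b} → (∀ {x} → x ∈ X → ∥ R x ∩ Y ∥ ≤ b) → edges R X Y ≤ b * ∥ X ∥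
  edges-≤ {R = R} {X} {Y} {b} h =
    ≤-trans (∑-mono pointwise) (≤-reflexive (∑-* b (𝟙 ∘ X)))
    where
    pointwise : ∀ x → 𝟙 (X x) * ∥ R x ∩ Y ∥ ≤ b * 𝟙 (X x)
    pointwise x with x ∈? X
    ... | yes p = subst (λ i → i * _ ≤ b * i) (sym (𝟙-∈ p))
                    (≤-trans (≤-reflexive (+-identityʳ _)) (≤-trans (h p) (≤-reflexive (sym (*-identityʳ b)))))
    ... | no p  = subst (λ i → i * _ ≤ b * i) (sym (n≤0⇒n≡0 (𝟙-bound {x = x} {X} (⊥-elim ∘ p)))) z≤n

  edges-mono : ∀ {R : Relation N} {X X′ Y} → X ⊆ X′ → edges R X Y ≤ edges R X′ Y
  edges-mono {R = R} {X} {X′} {Y} i = ∑-mono λ x → *-monoˡ-≤ ∥ R x ∩ Y ∥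
    (𝟙-bound {x = x} {X} λ p → ≤-reflexive (sym (𝟙-∈ (i p))))

  edges-inhabited : ∀ {R : Relation N} {X Y} → 0 < edges R X Y → ∃ λ x → x ∈ X
  edges-inhabited {R = R} {X} {Y} p with any? (_∈? X)
  ... | yes q = q
  ... | no q  = ⊥-elim (n≮0 (<-≤-trans p (≤-trans
    (edges-≤ {R = R} {X} {Y} {0} (λ r → ⊥-elim (q (_ , r)))) z≤n)))

∥remove∥ : ∀ {x : Fin N} {U} → x ∈ U → suc ∥ U ∖ ⁅ x ⁆ ∥ ≤ ∥ U ∥
∥remove∥ {x = x} {U} p = subst (λ i → i + ∥ U ∖ ⁅ x ⁆ ∥ ≤ ∥ U ∥) (∥⁅⁆∥ x)
  (∥∥-disjoint (λ q → subst (_∈ U) (⁅⁆-e q) p) ∖-l (λ q r → ∖-r r q))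

-- Deleting a vertex of degree below w destroys fewer than w edges, so more than w edges per
-- vertex remain.
module _ (R : Relation N) (w : ℕ) where

  record MinDegree (Lo Hi : Sub N) : Set where
    field
      Lo′ Hi′ : Sub N
      lo⊆ : Lo′ ⊆ Lo
      hi⊆ : Hi′ ⊆ Hi
      up : ∀ {x} → x ∈ Lo′ → w ≤ ∥ R x ∩ Hi′ ∥
      down : ∀ {y} → y ∈ Hi′ → w ≤ ∥ flip R y ∩ Lo′ ∥
      vertex : ∃ λ x → x ∈ Lo′

  clean : ∀ fuel Lo Hi → ∥ Lo ∥ + ∥ Hi ∥ ≤ fuel → w * (∥ Lo ∥ + ∥ Hi ∥) < edges R Lo Hi → MinDegree Lo Hi
  clean fuel Lo Hi f dense with any? (λ x → (x ∈? Lo) ×-dec (∥ R x ∩ Hi ∥ <? w))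
                              | any? (λ y → (y ∈? Hi) ×-dec (∥ flip R y ∩ Lo ∥ <? w))
  clean zero Lo Hi f dense | yes (x , p , _) | _ =
    ⊥-elim (n≮0 (<-≤-trans (∥∥-inhabited p) (≤-trans (m≤m+n _ _) f)))
  clean (suc fuel) Lo Hi f dense | yes (x , p , small) | _ =
    let shrink = +-monoˡ-≤ ∥ Hi ∥ (∥remove∥ p)
        open MinDegree (clean fuel (Lo ∖ ⁅ x ⁆) Hi (s≤s⁻¹ (≤-trans shrink f))
          (+-cancelʳ-< w _ _ (<-≤-trans (≤-<-trans (≤-reflexive (+-comm _ w)) (≤-<-trans
             (≤-trans (≤-reflexive (sym (*-suc w _))) (*-monoʳ-≤ w shrink)) dense))
             (≤-trans (edges-remove R Lo Hi x) (+-monoʳ-≤ _ (<⇒≤ small))))))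
    in record { Lo′ = Lo′ ; Hi′ = Hi′ ; lo⊆ = ∖-l ∘ lo⊆ ; hi⊆ = hi⊆ ; up = up ; down = down ; vertex = vertex }
  clean zero Lo Hi f dense | no _ | yes (y , p , _) =
    ⊥-elim (n≮0 (<-≤-trans (∥∥-inhabited p) (≤-trans (m≤n+m _ ∥ Lo ∥) f)))
  clean (suc fuel) Lo Hi f dense | no _ | yes (y , p , small) =
    let shrink = ≤-trans (≤-reflexive (sym (+-suc ∥ Lo ∥ _))) (+-monoʳ-≤ ∥ Lo ∥ (∥remove∥ p))
        remove = ≤-trans (≤-reflexive (edges-flip R Lo Hi)) (≤-trans (edges-remove (flip R) Hi Lo y)
                   (+-mono-≤ (≤-reflexive (sym (edges-flip R Lo (Hi ∖ ⁅ y ⁆)))) (<⇒≤ small)))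
        open MinDegree (clean fuel Lo (Hi ∖ ⁅ y ⁆) (s≤s⁻¹ (≤-trans shrink f))
          (+-cancelʳ-< w _ _ (<-≤-trans (≤-<-trans (≤-reflexive (+-comm _ w)) (≤-<-trans
             (≤-trans (≤-reflexive (sym (*-suc w _))) (*-monoʳ-≤ w shrink)) dense)) remove)))
    in record { Lo′ = Lo′ ; Hi′ = Hi′ ; lo⊆ = lo⊆ ; hi⊆ = ∖-l ∘ hi⊆ ; up = up ; down = down ; vertex = vertex }
  clean fuel Lo Hi f dense | no p | no q = record
    { Lo′ = Lo ; Hi′ = Hi ; lo⊆ = id ; hi⊆ = id
    ; up = λ x∈ → ≮⇒≥ λ small → p (_ , x∈ , small)
    ; down = λ y∈ → ≮⇒≥ λ small → q (_ , y∈ , small)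
    ; vertex = edges-inhabited {R = R} (≤-<-trans z≤n dense) }

-- Within `S` the in-degrees have the same sum as the out-degrees, at most `b * ∥ S ∥`, so at most
-- half of `S` has in-degree `2 * b` or more.
halve : ∀ {R : Relation N} {S b} → (∀ {x} → x ∈ S → ∥ R x ∩ S ∥ < b) → 0 < b →
        ∃ λ S′ → S′ ⊆ S × ∥ S ∥ ≤ 2 * ∥ S′ ∥ × (∀ {x} → x ∈ S′ → ∥ R x ∩ S′ ∥ < 2 * b × ∥ flip R x ∩ S′ ∥ < 2 * b)
halve {R = R} {S} {b} sparse 0<b =
  S′ , proj₁ ∘ ⟦⟧-e , big , λ x∈ →
    let x∈S , d = ⟦⟧-e x∈
    in ≤-<-trans (∥∥-mono shrink) (<-≤-trans (sparse x∈S) (m≤m+n b _)) , ≤-<-trans (∥∥-mono shrink) d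
  where
  S′ : Sub _
  S′ = ⟦ (λ x → (x ∈? S) ×-dec (∥ flip R x ∩ S ∥ <? 2 * b)) ⟧
  shrink : ∀ {x} {Q : Sub _} → x ∈ Q ∩ S′ → x ∈ Q ∩ S
  shrink q = ∩-i (∩-l q) (proj₁ (⟦⟧-e (∩-r q)))
  many : b * (2 * ∥ S ∖ S′ ∥) ≤ b * ∥ S ∥
  many = begin
    b * (2 * ∥ S ∖ S′ ∥)         ≡⟨ trans (sym (*-assoc b 2 _)) (cong (_* ∥ S ∖ S′ ∥) (*-comm b 2)) ⟩
    2 * b * ∥ S ∖ S′ ∥           ≤⟨ edges-≥ (λ q → ≮⇒≥ λ d → ∖-r q (⟦⟧-i (∖-l q , d))) ⟩
    edges (flip R) (S ∖ S′) S    ≤⟨ edges-mono ∖-l ⟩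
    edges (flip R) S S           ≡⟨ edges-flip (flip R) S S ⟩
    edges R S S                  ≤⟨ edges-≤ (<⇒≤ ∘ sparse) ⟩
    b * ∥ S ∥                    ∎
    where open ≤-Reasoning
  big : ∥ S ∥ ≤ 2 * ∥ S′ ∥
  big = +-cancelʳ-≤ (∥ S ∥) _ _ (begin
    ∥ S ∥ + ∥ S ∥                     ≡⟨ cong (∥ S ∥ +_) (sym (+-identityʳ _)) ⟩
    2 * ∥ S ∥                         ≤⟨ *-monoʳ-≤ 2 (∥∖∥ S S′) ⟩
    2 * (∥ S ∖ S′ ∥ + ∥ S′ ∥)         ≡⟨ *-distribˡ-+ 2 ∥ S ∖ S′ ∥ _ ⟩
    2 * ∥ S ∖ S′ ∥ + 2 * ∥ S′ ∥       ≤⟨ +-monoˡ-≤ _ (*-cancelˡ-≤ b {{>-nonZero 0<b}} many) ⟩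
    ∥ S ∥ + 2 * ∥ S′ ∥                ≡⟨ +-comm ∥ S ∥ _ ⟩
    2 * ∥ S′ ∥ + ∥ S ∥                ∎)
    where open ≤-Reasoning

-- Existence statements are needed only doubly negated, since Copy is decidable.
¬¬_ : Set → Set
¬¬ A = (A → ⊥) → ⊥

-- From arborescences to trees

dir? : ∀ (σ s : Dir) → σ ≡ s ⊎ opp σ ≡ s
dir? fwd fwd = inj₁ refl
dir? fwd bwd = inj₂ refl
dir? bwd fwd = inj₂ refl
dir? bwd bwd = inj₁ refl

opp-opp : ∀ σ → opp (opp σ) ≡ σ
opp-opp fwd = refl
opp-opp bwd = refl

-- The part of the tree that is reached from the root by edges of direction `σ` only. Edges between
-- it and the rest have direction `opp σ`, seen from the root.
core : Dir → Tree → Tree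
core σ • = •
core σ (t ◂[ s ] u) with dir? σ s
... | inj₁ _ = core σ t ◂[ s ] core σ u
... | inj₂ _ = core σ t

size-core : ∀ σ t → size (core σ t) ≤ size t
size-core σ • = ≤-refl
size-core σ (t ◂[ s ] u) with dir? σ s
... | inj₁ _ = +-mono-≤ (size-core σ t) (size-core σ u)
... | inj₂ _ = ≤-trans (size-core σ t) (m≤m+n _ _)

-- A tree decomposes into out-arborescences placed in side fwd and in-arborescences placed in
-- side bwd, each hanging by a single edge from an earlier one on the other side.
module Alternate (R : Relation N) {V : Sub N} (side : Dir → Sub N) (side⊆ : ∀ σ → side σ ⊆ V) {n w₀ w : ℕ}
         (arbs : ∀ σ {X} → X ⊆ side σ → w₀ ≤ ∥ X ∥ → ∀ t → size t ≤ n → ¬¬ Has (arb (along R σ)) t X)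
         (deg : ∀ σ {x} → x ∈ side (opp σ) → w ≤ ∥ along R σ x ∩ side σ ∥) (w₀+n≤w : w₀ + n ≤ w) where

  -- Different pieces are joined only by edges from side `bwd` to side `fwd`: a piece in side `fwd`
  -- is left by backward edges, one in side `bwd` by forward edges. The sides may overlap; it is `Y`
  -- that keeps the pieces disjoint.
  extend : ∀ σ t {x C} Y → Emb (arb (along R σ)) (core σ t) x C → C ⊆ side σ →
           (∀ {z} → z ∈ C → z ∈ Y → ⊥) → ∥ Y ∥ + size t ≤ n →
           (∀ {X} → X ⊆ V → Emb (along R) t x X → (∀ {z} → z ∈ X → z ∈ Y → ⊥) → ⊥) → ⊥
  extend σ • Y point C⊆ C∥Y b k = k (side⊆ σ ∘ C⊆) point C∥Y
  extend σ (t ◂[ s ] u) Y e C⊆ C∥Y b k with dir? σ s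
  extend σ (t ◂[ s ] u) Y (graft {X = C} {C′} e f d r) C⊆ C∥Y b k | inj₁ refl =
    -- The part of the core that belongs to `u` is reserved while `t` is completed.
    extend σ t (Y ∪ C′) e (C⊆ ∘ ∪-l) (λ p q → [ C∥Y (∪-l p) , d p ]′ (∪-e q)) bt λ {X} X⊆ e′ X∥ →
    extend σ u (Y ∪ X) f (C⊆ ∘ ∪-r) (λ p q → [ C∥Y (∪-r p) , (λ q → X∥ q (∪-r p)) ]′ (∪-e q)) (bu (Emb-size e′)) λ {Z} Z⊆ f′ Z∥ →
    k (λ q → [ X⊆ , Z⊆ ]′ (∪-e q)) (graft e′ f′ (λ p q → Z∥ q (∪-r p)) r)
      (λ p q → [ (λ p → X∥ p (∪-l q)) , (λ p → Z∥ p (∪-l q)) ]′ (∪-e p))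
    where
    bt : ∥ Y ∪ C′ ∥ + size t ≤ n
    bt = ≤-trans (+-monoˡ-≤ (size t) (≤-trans (∥∪∥ Y C′) (+-monoʳ-≤ ∥ Y ∥ (≤-trans (Emb-size f) (size-core σ u)))))
                 (≤-trans (≤-reflexive (trans (+-assoc ∥ Y ∥ _ _) (cong (∥ Y ∥ +_) (+-comm (size u) (size t))))) b)
    bu : ∀ {X} → ∥ X ∥ ≤ size t → ∥ Y ∪ X ∥ + size u ≤ n
    bu {X} le = ≤-trans (+-monoˡ-≤ (size u) (≤-trans (∥∪∥ Y X) (+-monoʳ-≤ ∥ Y ∥ le)))
                        (≤-trans (≤-reflexive (+-assoc ∥ Y ∥ _ _)) b)
  extend σ (t ◂[ s ] u) {x} Y e C⊆ C∥Y b k | inj₂ refl =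
    extend σ t Y e C⊆ C∥Y (≤-trans (+-monoʳ-≤ ∥ Y ∥ (m≤m+n _ _)) b) λ {X} X⊆ e′ X∥ →
    let c = ≤-trans (+-monoˡ-≤ (size u) (≤-trans (∥∪∥ Y X) (+-monoʳ-≤ ∥ Y ∥ (Emb-size e′))))
                    (≤-trans (≤-reflexive (+-assoc ∥ Y ∥ _ _)) b)
        room = +-cancelʳ-≤ n _ _ (≤-trans w₀+n≤w (≤-trans (deg s (subst (λ τ → x ∈ side τ) (sym (opp-opp σ)) (C⊆ (Emb-root e))))
                 (≤-trans (∥∖∥ _ (Y ∪ X)) (+-monoʳ-≤ _ (≤-trans (m≤m+n _ _) c)))))
    -- The core of `u` is found among the free neighbours of `x`, so its root is adjacent to `x`. At
    -- least `w₀` neighbours are free, since at most `n` vertices are forbidden.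
    in arbs s {(along R s x ∩ side s) ∖ (Y ∪ X)} (∩-r ∘ ∖-l) room (core s u)
            (≤-trans (size-core s u) (≤-trans (m≤n+m _ (∥ Y ∪ X ∥)) c)) λ (y , D , D⊆ , f) →
       extend s u (Y ∪ X) f (∩-r ∘ ∖-l ∘ D⊆) (∖-r ∘ D⊆) c λ {Z} Z⊆ f′ Z∥ →
       k (λ q → [ X⊆ , Z⊆ ]′ (∪-e q)) (graft e′ f′ (λ p q → Z∥ q (∪-r p)) (∩-l (∖-l (D⊆ (Emb-root f)))))
         (λ p q → [ (λ p → X∥ p q) , (λ p → Z∥ p (∪-l q)) ]′ (∪-e p))

-- At least half of `V` has out-degree `4 * w` or more. This half `Lo` sends at least
-- `4 * w * ∥ Lo ∥` edges into `V`, whereas cleaning can afford to lose `w * (∥ Lo ∥ + ∥ V ∥)`,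
-- which is at most `3 * w * ∥ Lo ∥`. What survives is the bipartite graph for `Alternate`.
arborescences⇒trees :
  ∀ {R : Relation N} {V n w₀ w} →
  (∀ σ {X} → X ⊆ V → w₀ ≤ ∥ X ∥ → ∀ t → size t ≤ n → ¬¬ Has (arb (along R σ)) t X) →
  w₀ + n ≤ w → 0 < w → 0 < ∥ V ∥ → 2 * ∥ ⟦ (λ x → (x ∈? V) ×-dec (∥ R x ∩ V ∥ <? 4 * w)) ⟧ ∥ ≤ ∥ V ∥ →
  ∀ t → size t ≤ n → ¬¬ Has (along R) t V
arborescences⇒trees {N} {R} {V} {n} {w₀} {w} arbs w₀+n≤w 0<w 0<V few t t≤n k =
  arbs fwd {R x ∩ Hi′} (hi⊆ ∘ ∩-r) (≤-trans (≤-trans (m≤m+n w₀ n) w₀+n≤w) (up x∈)) (core fwd t)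
       (≤-trans (size-core fwd t) t≤n) λ (y , C , C⊆ , e) →
  extend fwd t ∅ e (∩-r ∘ C⊆) (λ _ → ∈∅) (≤-trans (≤-reflexive (cong (_+ size t) (∥∅∥ {N}))) t≤n)
    λ {X} X⊆ e′ _ → k (y , X , X⊆ , e′)
  where
  Lo Few : Sub N
  Lo  = ⟦ (λ x → (x ∈? V) ×-dec (4 * w ≤? ∥ R x ∩ V ∥)) ⟧
  Few = ⟦ (λ x → (x ∈? V) ×-dec (∥ R x ∩ V ∥ <? 4 * w)) ⟧
  half : ∥ V ∥ ≤ 2 * ∥ Lo ∥
  half = +-cancelʳ-≤ ∥ V ∥ _ _ (begin
    ∥ V ∥ + ∥ V ∥               ≡⟨ cong (∥ V ∥ +_) (sym (+-identityʳ _)) ⟩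
    2 * ∥ V ∥                   ≤⟨ *-monoʳ-≤ 2 (∥∥-cover {W = Lo} {Few} λ {x} p → case 4 * w ≤? ∥ R x ∩ V ∥ of λ where
                                     (yes q) → inj₁ (⟦⟧-i (p , q))
                                     (no q)  → inj₂ (⟦⟧-i (p , ≰⇒> q))) ⟩
    2 * (∥ Lo ∥ + ∥ Few ∥)      ≡⟨ *-distribˡ-+ 2 ∥ Lo ∥ _ ⟩
    2 * ∥ Lo ∥ + 2 * ∥ Few ∥    ≤⟨ +-monoʳ-≤ _ few ⟩
    2 * ∥ Lo ∥ + ∥ V ∥          ∎)
    where open ≤-Reasoning
  0<Lo : 0 < ∥ Lo ∥
  0<Lo = n≢0⇒n>0 λ eq → n≮0 (<-≤-trans 0<V (≤-trans half (≤-reflexive (cong (2 *_) eq))))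
  dense : w * (∥ Lo ∥ + ∥ V ∥) < edges R Lo V
  dense = begin-strict
    w * (∥ Lo ∥ + ∥ V ∥)           ≤⟨ *-monoʳ-≤ w (+-monoʳ-≤ ∥ Lo ∥ half) ⟩
    w * (∥ Lo ∥ + 2 * ∥ Lo ∥)      <⟨ m<m+n _ (*-mono-≤ 0<w 0<Lo) ⟩
    w * (∥ Lo ∥ + 2 * ∥ Lo ∥) + w * ∥ Lo ∥ ≡⟨ collect w ∥ Lo ∥ ⟩
    4 * w * ∥ Lo ∥                 ≤⟨ edges-≥ (proj₂ ∘ ⟦⟧-e) ⟩
    edges R Lo V                   ∎
    where
    open ≤-Reasoning
    collect : ∀ w l → w * (l + 2 * l) + w * l ≡ 4 * w * l
    collect = solve-∀
  open MinDegree (clean R w _ Lo V ≤-refl dense)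
  x : Fin N
  x = proj₁ vertex
  x∈ : x ∈ Lo′
  x∈ = proj₂ vertex
  sides : Dir → Sub N
  sides fwd = Hi′
  sides bwd = Lo′
  sides⊆ : ∀ σ → sides σ ⊆ V
  sides⊆ fwd = hi⊆
  sides⊆ bwd = proj₁ ∘ ⟦⟧-e ∘ lo⊆
  degs : ∀ σ {x} → x ∈ sides (opp σ) → w ≤ ∥ along R σ x ∩ sides σ ∥
  degs fwd = up
  degs bwd = down
  open Alternate R sides sides⊆ (λ σ i → arbs σ (sides⊆ σ ∘ i)) degs w₀+n≤w

-- Arborescences in sets without sparse parts

-- A tree with fewer than 2 h vertices has a path from its root such that every subtree
-- hanging from the path has fewer than h vertices; U (suc a) hosts the path, U a the subtrees.
module Chain (R : Relation N) (W : Sub N) {n m u b s κ d : ℕ}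
         (paths : ∀ {X} → X ⊆ W → u ≤ ∥ X ∥ → ¬¬ HasPath R X n)
         (small : ∀ {X} → X ⊆ W → u ≤ ∥ X ∥ → ∀ t → size t ≤ m → ¬¬ Has (arb R) t X)
         (rich : ∀ {S} → S ⊆ W → s ≤ ∥ S ∥ → ¬ (∀ {x} → x ∈ S → ∥ R x ∩ S ∥ < b))
         (u+κ≤b : u + κ ≤ b) where

  U : ℕ → Sub N
  U zero    = W
  U (suc a) = ⟦ (λ x → (x ∈? U a) ×-dec (b ≤? ∥ R x ∩ U a ∥)) ⟧

  U⊆W : ∀ a → U a ⊆ W
  U⊆W zero    = id
  U⊆W (suc a) = U⊆W a ∘ proj₁ ∘ ⟦⟧-e

  U-large : ∀ a → ∥ W ∥ ≤ ∥ U a ∥ + a * s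
  U-large zero    = m≤m+n _ _
  U-large (suc a) = begin
    ∥ W ∥                            ≤⟨ U-large a ⟩
    ∥ U a ∥ + a * s                  ≤⟨ +-monoˡ-≤ (a * s) (≤-trans (∥∖∥ (U a) (U (suc a))) (+-monoˡ-≤ _ (<⇒≤ lost))) ⟩
    s + ∥ U (suc a) ∥ + a * s        ≡⟨ regroup s ∥ U (suc a) ∥ (a * s) ⟩
    ∥ U (suc a) ∥ + (s + a * s)      ∎
    where
    open ≤-Reasoning
    regroup : ∀ x y z → x + y + z ≡ y + (x + z)
    regroup = solve-∀
    lost : ∥ U a ∖ U (suc a) ∥ < s
    lost = ≰⇒> λ le → rich (U⊆W a ∘ ∖-l) le λ q →
      ≤-<-trans (∥∥-mono λ r → ∩-i (∩-l r) (∖-l (∩-r r))) (≰⇒> λ h → ∖-r q (⟦⟧-i (∖-l q , h)))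

  room : ∀ {X Y : Sub N} → b ≤ ∥ X ∥ → ∥ Y ∥ ≤ κ → u ≤ ∥ X ∖ Y ∥
  room {X} {Y} big le = +-cancelʳ-≤ κ _ _ (≤-trans u+κ≤b (≤-trans big (≤-trans (∥∖∥ X Y) (+-monoʳ-≤ _ le))))

  mutual
    -- One round forbids at most `n` vertices for its path and `n` for the tree grown along it;
    -- hence the reserve of `2 * n` for each round to come.
    place : ∀ a {X₀} Y t → X₀ ⊆ U a → b ≤ ∥ X₀ ∥ → size t < 2 ^ a * suc m → size t ≤ n →
            ∥ Y ∥ + a * (2 * n) ≤ κ →
            (∀ {x X} → x ∈ X₀ → X ⊆ W → Emb (arb R) t x X → (∀ {z} → z ∈ X → z ∈ Y → ⊥) → ⊥) → ⊥
    place zero {X₀} Y t X₀⊆ big t< t≤n budget k =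
      small {X₀ ∖ Y} (X₀⊆ ∘ ∖-l) (room big (≤-trans (m≤m+n _ _) budget)) t
            (s≤s⁻¹ (≤-trans t< (≤-reflexive (+-identityʳ (suc m))))) λ (x , X , X⊆ , e) →
      k (∖-l (X⊆ (Emb-root e))) (X₀⊆ ∘ ∖-l ∘ X⊆) e (∖-r ∘ X⊆)
    place (suc a) {X₀} Y t X₀⊆ big t< t≤n budget k =
      paths {X₀ ∖ Y} (U⊆W (suc a) ∘ X₀⊆ ∘ ∖-l) (room big (≤-trans (m≤m+n _ _) budget)) λ (x , p , i , w , len) →
      spine a t Y w (X₀⊆ ∘ ∖-l ∘ i) (∖-r ∘ i) (inj₂ (≤-trans t≤n (≤-reflexive (sym len))))
            (<-≤-trans t< (≤-reflexive (*-assoc 2 (2 ^ a) (suc m)))) t≤n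
            (≤-trans (+-monoˡ-≤ (a * (2 * n)) (+-mono-≤ (+-monoʳ-≤ ∥ Y ∥ (≤-trans (n≤1+n _) (≤-reflexive len))) t≤n))
              (≤-trans (≤-reflexive (regroup ∥ Y ∥ n (a * (2 * n)))) budget))
            λ X⊆ e X∥Y → k (∖-l (i (∪-l ⁅⁆-i))) X⊆ e X∥Y
      where
      regroup : ∀ y n r → y + n + n + r ≡ y + (2 * n + r)
      regroup = solve-∀

    -- The given path receives the heavy path of `t`. With h = `2 ^ a * suc m`, a tree of fewer than
    -- 2 h vertices has at most one subtree of h or more at its root. That one moves to the next
    -- vertex of the path, the light ones into the out-neighbourhood of `x` in `U a`. The
    -- disjunction says that no heavy subtree is left or that the rest of the path is long enough.
    spine : ∀ a t {x p} Y → Path R x p → elems (x ∷ p) ⊆ U (suc a) → (∀ {z} → z ∈ elems (x ∷ p) → z ∈ Y → ⊥) →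
            size t < 2 ^ a * suc m ⊎ size t ≤ suc (length p) → size t < 2 * (2 ^ a * suc m) → size t ≤ n →
            ∥ Y ∥ + length p + size t + a * (2 * n) ≤ κ →
            (∀ {X} → X ⊆ W → Emb (arb R) t x X → (∀ {z} → z ∈ X → z ∈ Y → ⊥) → ⊥) → ⊥
    spine a • {x} Y w i p∥Y _ _ _ _ k =
      k (λ q → subst (_∈ W) (⁅⁆-e q) (U⊆W (suc a) (i (∪-l ⁅⁆-i)))) point (p∥Y ∘ ∪-l)
    spine a (t ◂[ s ] u) {x} {p} Y w i p∥Y path< t< t≤n budget k with size u <? 2 ^ a * suc m
    ... | yes u< =
      spine a t Y w i p∥Y ([ (λ h → inj₁ (≤-<-trans (m≤m+n _ _) h)) , (λ h → inj₂ (≤-trans (m≤m+n _ _) h)) ]′ path<)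
            (≤-<-trans (m≤m+n _ _) t<) (≤-trans (m≤m+n _ _) t≤n)
            (≤-trans (+-monoˡ-≤ (a * (2 * n)) (+-monoʳ-≤ (∥ Y ∥ + length p) (m≤m+n _ _))) budget) λ {X} X⊆ e X∥ →
      place a {R x ∩ U a} (Y ∪ X) u ∩-r (proj₂ (⟦⟧-e (i (∪-l ⁅⁆-i)))) u< (≤-trans (m≤n+m _ (size t)) t≤n)
            (≤-trans (+-monoˡ-≤ (a * (2 * n)) (≤-trans (∥∪∥ Y X) (≤-trans (+-monoʳ-≤ ∥ Y ∥ (Emb-size e))
               (+-mono-≤ (m≤m+n ∥ Y ∥ (length p)) (m≤m+n (size t) (size u)))))) budget) λ {y} {Z} y∈ Z⊆ f Z∥ →
      k (λ q → [ X⊆ , Z⊆ ]′ (∪-e q)) (graft e f (λ p q → Z∥ q (∪-r p)) (∩-l y∈))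
        (λ p q → [ (λ p → X∥ p q) , (λ p → Z∥ p (∪-l q)) ]′ (∪-e p))
    ... | no u≮ with w
    ...   | end = ⊥-elim ([ (λ h → u≮ (≤-<-trans (m≤n+m _ (size t)) h))
                          , (λ h → <⇒≱ (+-mono-≤ (0<size t) (0<size u)) h) ]′ path<)
    ...   | step {y = y} {p′} r x∉ w′ =
      -- Beside a heavy `u`, the remainder `t` is light and needs no path; the rest of the path is
      -- kept free for `u`.
      spine a t (Y ∪ elems p) end (insert-⊆ (i (∪-l ⁅⁆-i)) (⊥-elim ∘ ∈∅))
            (λ q q′ → [ (λ e → [ (λ q′ → p∥Y (∪-l e) q′) , (λ q′ → x∉ (subst (_∈ elems p) (sym (⁅⁆-e e)) q′)) ]′ (∪-e q′)) , ∈∅ ]′ (∪-e q))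
            (inj₁ t<h) (<-≤-trans t<h (m≤m+n _ _)) (≤-trans (m≤m+n _ _) t≤n) bt λ {X} X⊆ e X∥ →
      spine a u (Y ∪ X) w′ (i ∘ ∪-r) (λ q q′ → [ p∥Y (∪-r q) , (λ q′ → X∥ q′ (∪-r q)) ]′ (∪-e q′))
            (inj₂ u≤) (≤-<-trans (m≤n+m _ (size t)) t<) (≤-trans (m≤n+m _ (size t)) t≤n) (bu (Emb-size e)) λ {Z} Z⊆ f Z∥ →
      k (λ q → [ X⊆ , Z⊆ ]′ (∪-e q)) (graft e f (λ p q → Z∥ q (∪-r p)) r)
        (λ p q → [ (λ p → X∥ p (∪-l q)) , (λ p → Z∥ p (∪-l q)) ]′ (∪-e p))
      where
      h : ℕ
      h = 2 ^ a * suc m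
      t<h : size t < h
      t<h = +-cancelʳ-< h _ _ (≤-<-trans (+-monoʳ-≤ (size t) (≮⇒≥ u≮)) (<-≤-trans t< (≤-reflexive (cong (h +_) (+-identityʳ h)))))
      u≤ : size u ≤ suc (length p′)
      u≤ = [ (λ lt → ⊥-elim (u≮ (≤-<-trans (m≤n+m _ (size t)) lt)))
           , (λ le → s≤s⁻¹ (≤-trans (+-monoˡ-≤ (size u) (0<size t)) le)) ]′ path<
      bt : ∥ Y ∪ elems p ∥ + 0 + size t + a * (2 * n) ≤ κ
      bt = ≤-trans (+-monoˡ-≤ (a * (2 * n)) (+-mono-≤ (≤-trans (≤-reflexive (+-identityʳ _))
                     (≤-trans (∥∪∥ Y (elems p)) (+-monoʳ-≤ ∥ Y ∥ (∥elems∥ p)))) (m≤m+n _ (size u)))) budget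
      bu : ∀ {X} → ∥ X ∥ ≤ size t → ∥ Y ∪ X ∥ + length p′ + size u + a * (2 * n) ≤ κ
      bu {X} le = ≤-trans (+-monoˡ-≤ (a * (2 * n)) (≤-trans (+-monoˡ-≤ (size u) (+-mono-≤
                    (≤-trans (∥∪∥ Y X) (+-monoʳ-≤ ∥ Y ∥ le)) (n≤1+n (length p′))))
                    (≤-reflexive (regroup ∥ Y ∥ (size t) (length p) (size u))))) budget
        where
        regroup : ∀ y t l u → y + t + l + u ≡ y + l + (t + u)
        regroup = solve-∀

  -- Each step from `U a` to `U (suc a)` loses fewer than `s` vertices, so `U d` still has `b`; and
  -- `d` halvings lead from size `n` down to `m`.
  arborescences : d * (2 * n) ≤ κ → d * s + b ≤ ∥ W ∥ → n < 2 ^ d * suc m → ∀ t → size t ≤ n → ¬¬ Has (arb R) t W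
  arborescences κ-large W-large n< t t≤n k =
    place d ∅ t id
      (+-cancelʳ-≤ (d * s) _ _ (≤-trans (≤-reflexive (+-comm b _)) (≤-trans W-large (U-large d))))
      (≤-<-trans t≤n n<) t≤n (≤-trans (≤-reflexive (cong (_+ d * (2 * n)) (∥∅∥ {N}))) κ-large)
      λ {x} {X} x∈ X⊆ e _ → k (x , X , X⊆ , e)

-- An arborescence is itself an oriented tree, with all edges directed alike, so that a hypothesis
-- on small trees yields small arborescences.
mono : Dir → Tree → Tree
mono σ • = •
mono σ (t ◂[ _ ] u) = mono σ t ◂[ σ ] mono σ u

size-mono : ∀ σ t → size (mono σ t) ≡ size t
size-mono σ • = refl
size-mono σ (t ◂[ _ ] u) = cong₂ _+_ (size-mono σ t) (size-mono σ u)

Emb-mono : ∀ {A : Dir → Relation N} σ t {x X} → Emb A (mono σ t) x X → Emb (arb (A σ)) t x X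
Emb-mono σ • point = point
Emb-mono σ (t ◂[ _ ] u) (graft e f d r) = graft (Emb-mono σ t e) (Emb-mono σ u f) d r

quotient : ℕ → ℕ → ℕ
quotient d n = (n / 2 ^ d) {{m^n≢0 2 d}}

quotient-< : ∀ d n → n < 2 ^ d * suc (quotient d n)
quotient-< d n = begin-strict
  n                                  ≡⟨ m≡m%n+[m/n]*n n (2 ^ d) ⟩
  _ + quotient d n * 2 ^ d           <⟨ +-monoˡ-< (quotient d n * 2 ^ d) (m%n<n n (2 ^ d)) ⟩
  2 ^ d + quotient d n * 2 ^ d       ≡⟨ *-comm (suc (quotient d n)) (2 ^ d) ⟩
  2 ^ d * suc (quotient d n)         ∎
  where
  open ≤-Reasoning
  instance _ = m^n≢0 2 d

-- If sets of α X vertices contain all small trees, then φ X vertices are enough for dominate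
-- below, where ω X is the degree required on both sides of the bipartite graph.
opaque
  ω φ : ℕ → ℕ → ℕ → ℕ
  ω d A α = d * (2 * (A * (1 + 2 * (α + 2 * d)))) + (α + 2 * d) + 1
  φ d A α = 2 * (2 * (A * (1 + 2 * (4 * ω d A α))))

  ω-def : ∀ d A α → ω d A α ≡ d * (2 * (A * (1 + 2 * (α + 2 * d)))) + (α + 2 * d) + 1
  ω-def d A α = refl

  φ-def : ∀ d A α → φ d A α ≡ 2 * (2 * (A * (1 + 2 * (4 * ω d A α))))
  φ-def d A α = refl

A≤φ : ∀ d A α → A ≤ φ d A α
A≤φ d A α = ≤-trans (≤-reflexive (sym (*-identityʳ A)))
  (≤-trans (*-monoʳ-≤ A (m≤m+n 1 (2 * (4 * ω d A α)))) (≤-trans (≤-trans (m≤m+n _ _) (m≤m+n _ _)) (≤-reflexive (sym (φ-def d A α)))))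

-- The number of colours that can still be dense is reduced one at a time. A colour is Dead if it
-- has small degrees. As long as two colours are alive, one of them contains all small trees in
-- all large sets; if that colour does not contain its tree, it is sparse on a large set.
module Colours {k N : ℕ} (G : Fin k → Relation N) (n : Fin k → ℕ) (t : Fin k → Tree) (t≤n : ∀ i → size (t i) ≤ n i)
  (V₀ : Sub N) (cover : ∀ {x y} → x ∈ V₀ → y ∈ V₀ → x ≢ y → ∃ λ i → y ∈ G i x)
  (d q : ℕ) (n≤q : ∀ i → n i ≤ q) (0<q : 0 < q)
  (paths : ∀ i σ {X} → X ⊆ V₀ → q ≤ ∥ X ∥ → ¬¬ HasPath (along (G i) σ) X (n i))
  (trees : ∀ {a b} → a ≢ b → ∀ {X} → X ⊆ V₀ → q ≤ ∥ X ∥ → ∀ K L →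
           size K ≤ quotient d (n a) → size L ≤ quotient d (n b) →
           ¬ Has (along (G a)) K X → ¬ Has (along (G b)) L X → ⊥)
  (avoids : ∀ i → ¬ Has (along (G i)) (t i) V₀) where

  Dead : ℕ → Sub N → Fin k → Set
  Dead D V i = ∀ {x} → x ∈ V → ∀ s → ∥ along (G i) s x ∩ V ∥ < D

  Dead-mono : ∀ {D D′ V V′ i} → D ≤ D′ → V′ ⊆ V → Dead D V i → Dead D′ V′ i
  Dead-mono le i dead x∈ s = ≤-<-trans (∥∥-mono λ q → ∩-i (∩-l q) (i (∩-r q))) (<-≤-trans (dead (i x∈) s) le)

  -- When a colour dies, `D` becomes `D + 2 * b` with `b` a multiple of `D + q`. In this unit, `A`
  -- can be chosen from `k`, `d` and `r` alone.
  Bounded : ℕ → ℕ → Set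
  Bounded r A = ∀ (alive : Sub k) D V → ∥ alive ∥ ≤ r → V ⊆ V₀ → (∀ i → i ∈ alive ⊎ Dead D V i) →
                A * (D + q) ≤ ∥ V ∥ → ⊥

  degrees : ∀ {V x} s → V ⊆ V₀ → x ∈ V → ∥ V ∥ ≤ 1 + ∑ λ i → ∥ along (G i) s x ∩ V ∥
  degrees {V} {x} s V⊆ x∈ = begin
    ∥ V ∥                                                     ≡⟨ ∥∥-∑ V ⟩
    ∑ (λ y → 𝟙 (V y))                                         ≤⟨ ∑-mono pointwise ⟩
    ∑ (λ y → 𝟙 (⁅ x ⁆ y) + ∑ λ i → 𝟙 ((along (G i) s x ∩ V) y)) ≡⟨ ∑-+ _ _ ⟩
    ∑ (𝟙 ∘ ⁅ x ⁆) + ∑ (λ y → ∑ λ i → 𝟙 ((along (G i) s x ∩ V) y))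
      ≡⟨ cong₂ _+_ (trans (sym (∥∥-∑ ⁅ x ⁆)) (∥⁅⁆∥ x))
                   (trans (∑-swap _) (∑-cong λ i → sym (∥∥-∑ (along (G i) s x ∩ V)))) ⟩
    1 + ∑ (λ i → ∥ along (G i) s x ∩ V ∥)                     ∎
    where
    open ≤-Reasoning
    coloured : ∀ s {y} → y ∈ V → x ≢ y → ∃ λ i → y ∈ along (G i) s x
    coloured fwd y∈ x≢y = cover (V⊆ x∈) (V⊆ y∈) x≢y
    coloured bwd y∈ x≢y = let i , r = cover (V⊆ y∈) (V⊆ x∈) (x≢y ∘ sym) in i , flip-i {R = G i} r
    pointwise : ∀ y → 𝟙 (V y) ≤ 𝟙 (⁅ x ⁆ y) + ∑ λ i → 𝟙 ((along (G i) s x ∩ V) y)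
    pointwise y = 𝟙-bound {x = y} {V} λ y∈ → case x ≟ y of λ where
      (yes refl) → ≤-trans (≤-reflexive (sym (𝟙-∈ ⁅⁆-i))) (m≤m+n _ _)
      (no x≢y)   → let i , r = coloured s y∈ x≢y in
                   ≤-trans (≤-trans (≤-reflexive (sym (𝟙-∈ (∩-i r y∈)))) (∑-term (λ i → 𝟙 ((along (G i) s x ∩ V) y)) i)) (m≤n+m _ _)

  room : ∀ D → suc (k * D + q) ≤ (k + 2) * (D + q)
  room D = ≤-trans (≤-reflexive (+-comm 1 _)) (≤-trans (+-monoʳ-≤ (k * D + q) 0<q)
             (≤-trans (m≤m+n _ (k * q + 2 * D)) (≤-reflexive (expand k D q))))
    where
    expand : ∀ k D q → k * D + q + q + (k * q + 2 * D) ≡ (k + 2) * (D + q)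
    expand = solve-∀

  -- Dead colours account for at most `k * D` neighbours of a vertex in either direction. The
  -- remaining colour thus has all degrees at least `q`, enough for `greedy`.
  bounded-one : Bounded 1 (k + 2)
  bounded-one alive D V le V⊆ dead big with any? (_∈? alive)
  ... | no none =
    let x , x∈ = inhabited (≤-trans (≤-trans (s≤s z≤n) (room D)) big)
    in <⇒≱ (≤-trans (s≤s (≤-trans (s≤s (∑-bound λ i → case dead i of λ where
                 (inj₁ p) → ⊥-elim (none (i , p))
                 (inj₂ p) → <⇒≤ (p x∈ fwd))) (≤-trans (≤-reflexive (+-comm 1 _)) (+-monoʳ-≤ (k * D) 0<q))))
               (≤-trans (room D) big)) (degrees fwd V⊆ x∈)
  ... | yes (i₀ , i₀∈) =
    let x , x∈ = inhabited (≤-trans (≤-trans (s≤s z≤n) (room D)) big)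
        X , X⊆ , e , _ = greedy deg (t i₀) ∅ x∈ ∈∅
                           (≤-trans (≤-reflexive (cong (_+ size (t i₀)) (∥∅∥ {N}))) (≤-trans (t≤n i₀) (n≤q i₀)))
    in avoids i₀ (x , X , V⊆ ∘ X⊆ , e)
    where
    only : ∀ i → i ∈ alive → i₀ ≡ i
    only i i∈ with i₀ ≟ i
    ... | yes eq = eq
    ... | no neq = ⊥-elim (<⇒≱ (≤-trans (s≤s (∥∥-inhabited (∖-i i∈ (neq ∘ ⁅⁆-e)))) (∥remove∥ i₀∈)) le)
    deg : ∀ {x} → x ∈ V → ∀ s → q ≤ ∥ along (G i₀) s x ∩ V ∥
    deg {x} x∈ s = +-cancelˡ-≤ (suc (k * D)) _ _ (begin
      suc (k * D) + q                                   ≤⟨ room D ⟩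
      (k + 2) * (D + q)                                 ≤⟨ big ⟩
      ∥ V ∥                                             ≤⟨ degrees s V⊆ x∈ ⟩
      suc (∑ λ i → ∥ along (G i) s x ∩ V ∥)             ≤⟨ s≤s (∑-mono split) ⟩
      suc (∑ λ i → D + 𝟙 (⁅ i₀ ⁆ i) * f)                ≡⟨ cong suc (∑-+ _ _) ⟩
      suc (∑ (const D) + ∑ λ i → 𝟙 (⁅ i₀ ⁆ i) * f)      ≤⟨ s≤s (+-mono-≤ (∑-bound λ _ → ≤-refl) (≤-reflexive (∑-point i₀ (const f)))) ⟩
      suc (k * D) + f                                   ∎)
      where
      open ≤-Reasoning
      f : ℕ
      f = ∥ along (G i₀) s x ∩ V ∥
      split : ∀ i → ∥ along (G i) s x ∩ V ∥ ≤ D + 𝟙 (⁅ i₀ ⁆ i) * f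
      split i with dead i
      ... | inj₂ p = ≤-trans (<⇒≤ (p x∈ s)) (m≤m+n _ _)
      ... | inj₁ p with only i p
      ...   | refl = ≤-trans (≤-reflexive (sym (trans (cong (_* f) (𝟙-∈ (⁅⁆-i {x = i₀}))) (+-identityʳ f)))) (m≤n+m _ D)

  module Step {r A : ℕ} (bounded : Bounded r A) {alive : Sub k} {D : ℕ} (≤r : ∥ alive ∥ ≤ suc r) where

    -- Sparseness is given in one direction only. On half of `S` it holds in both, up to a factor 2;
    -- there `c` is dead and `bounded` applies to the other colours.
    kill : ∀ {c V b} σ → V ⊆ V₀ → (∀ i → i ∈ alive ⊎ Dead D V i) → c ∈ alive → 0 < b →
           ∀ {S} → S ⊆ V → (∀ {x} → x ∈ S → ∥ along (G c) σ x ∩ S ∥ < b) →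
           2 * (A * (D + q + 2 * b)) ≤ ∥ S ∥ → ⊥
    kill {c} {V} {b} σ V⊆ dead c∈ 0<b {S} S⊆ sparse big with halve {R = along (G c) σ} sparse 0<b
    ... | S′ , S′⊆ , half , low =
      bounded (alive ∖ ⁅ c ⁆) (D + 2 * b) S′ (s≤s⁻¹ (≤-trans (∥remove∥ c∈) ≤r)) (V⊆ ∘ S⊆ ∘ S′⊆) dead′
        (≤-trans (≤-reflexive (cong (A *_) (swap D b q))) (*-cancelˡ-≤ 2 (≤-trans big half)))
      where
      swap : ∀ D b q → D + 2 * b + q ≡ D + q + 2 * b
      swap = solve-∀
      both : ∀ σ → (∀ {x} → x ∈ S′ → ∥ along (G c) σ x ∩ S′ ∥ < 2 * b × ∥ flip (along (G c) σ) x ∩ S′ ∥ < 2 * b) →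
             Dead (2 * b) S′ c
      both fwd low x∈ fwd = proj₁ (low x∈)
      both fwd low x∈ bwd = proj₂ (low x∈)
      both bwd low x∈ fwd = proj₂ (low x∈)
      both bwd low x∈ bwd = proj₁ (low x∈)
      dead′ : ∀ i → i ∈ (alive ∖ ⁅ c ⁆) ⊎ Dead (D + 2 * b) S′ i
      dead′ i with dead i | c ≟ i
      ... | inj₂ p | _        = inj₂ (Dead-mono (m≤m+n _ _) (S⊆ ∘ S′⊆) p)
      ... | inj₁ _ | yes refl = inj₂ (Dead-mono (m≤n+m _ D) id (both σ low))
      ... | inj₁ p | no c≢i   = inj₁ (∖-i p (c≢i ∘ ⁅⁆-e))

    dominate : ∀ {c V} α → V ⊆ V₀ → (∀ i → i ∈ alive ⊎ Dead D V i) → c ∈ alive → 0 < α →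
               (∀ {X} → X ⊆ V → α * (D + q) ≤ ∥ X ∥ → ∀ K → size K ≤ quotient d (n c) → ¬¬ Has (along (G c)) K X) →
               φ d A α * (D + q) ≤ ∥ V ∥ → ⊥
    dominate {c} {V} α V⊆ dead c∈ 0<α universal big =
      arborescences⇒trees arbs w₀+n≤w 0<w 0<V few (t c) (t≤n c) (avoids c ∘ Has-mono (along (G c)) V⊆)
      where
      -- A set of `s` vertices with degrees below `b` would kill `c`. In `β`, the `2 * d` pays for
      -- the vertices forbidden during the `d` rounds of `Chain`; in `w₀`, each round may lose `s`
      -- vertices and `b` must remain. The size `s′` is to `4 * w` what `s` is to `b`.
      e β b s w₀ w s′ : ℕ
      e  = D + q
      β  = α + 2 * d
      b  = β * e
      s  = 2 * (A * (e + 2 * b))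
      w₀ = d * s + b
      w  = w₀ + e
      s′ = 2 * (A * (e + 2 * (4 * w)))
      n≤e : n c ≤ e
      n≤e = ≤-trans (n≤q c) (m≤n+m q D)
      0<e : 0 < e
      0<e = ≤-trans 0<q (m≤n+m q D)
      0<b : 0 < b
      0<b = *-mono-≤ (≤-trans 0<α (m≤m+n α _)) 0<e
      w₀+n≤w : w₀ + n c ≤ w
      w₀+n≤w = +-monoʳ-≤ w₀ n≤e
      0<w : 0 < w
      0<w = ≤-trans 0<e (m≤n+m e w₀)
      w≡ : w ≡ ω d A α * e
      w≡ = trans (expand d A β e) (cong (_* e) (sym (ω-def d A α)))
        where
        expand : ∀ d A β e → d * (2 * (A * (e + 2 * (β * e)))) + β * e + e ≡ (d * (2 * (A * (1 + 2 * β))) + β + 1) * e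
        expand = solve-∀
      s′≡ : 2 * s′ ≡ φ d A α * e
      s′≡ = trans (cong (λ w → 2 * (2 * (A * (e + 2 * (4 * w))))) w≡) (trans (expand A (ω d A α) e) (cong (_* e) (sym (φ-def d A α))))
        where
        expand : ∀ A o e → 2 * (2 * (A * (e + 2 * (4 * (o * e))))) ≡ 2 * (2 * (A * (1 + 2 * (4 * o)))) * e
        expand = solve-∀
      2s′≤V : 2 * s′ ≤ ∥ V ∥
      2s′≤V = ≤-trans (≤-reflexive s′≡) big
      Few : Sub N
      Few = ⟦ (λ x → (x ∈? V) ×-dec (∥ G c x ∩ V ∥ <? 4 * w)) ⟧
      few : 2 * ∥ Few ∥ ≤ ∥ V ∥
      few = ≮⇒≥ λ lt → kill fwd V⊆ dead c∈ (≤-trans 0<w (m≤m+n w _)) (proj₁ ∘ ⟦⟧-e)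
        (λ x∈ → ≤-<-trans (∥∥-mono λ p → ∩-i (∩-l p) (proj₁ (⟦⟧-e (∩-r p)))) (proj₂ (⟦⟧-e x∈)))
        (<⇒≤ (*-cancelˡ-< 2 _ _ (≤-<-trans 2s′≤V lt)))
      -- Positivity of `A` is not assumed, so `big` alone does not exclude an empty `V`. But an
      -- empty `V` is vacuously sparse, and at least `s′` in size by `big`, so it would kill `c`.
      0<V : 0 < ∥ V ∥
      0<V = ≮⇒≥ λ lt → kill fwd V⊆ dead c∈ (≤-trans 0<w (m≤m+n w _)) id
        (λ {x} x∈ → ⊥-elim (<⇒≱ (∥∥-inhabited x∈) (s≤s⁻¹ lt)))
        (≤-trans (m≤m+n s′ _) 2s′≤V)
      κ≤ : α * e + d * (2 * n c) ≤ b
      κ≤ = ≤-trans (+-monoʳ-≤ (α * e) (*-monoʳ-≤ d (*-monoʳ-≤ 2 n≤e))) (≤-reflexive (expand α d e))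
        where
        expand : ∀ α d e → α * e + d * (2 * e) ≡ (α + 2 * d) * e
        expand = solve-∀
      arbs : ∀ σ {X} → X ⊆ V → w₀ ≤ ∥ X ∥ → ∀ t → size t ≤ n c → ¬¬ Has (arb (along (G c) σ)) t X
      arbs σ {X} X⊆ large =
        arborescences ≤-refl large
          (quotient-< d (n c))
        where
        open Chain (along (G c) σ) X {d = d}
          (λ Y⊆ le → paths c σ (V⊆ ∘ X⊆ ∘ Y⊆) (≤-trans (≤-trans (m≤n+m q D)
             (≤-trans (≤-reflexive (sym (+-identityʳ e))) (*-monoˡ-≤ e 0<α))) le))
          (λ Y⊆ le K K≤ h → universal (X⊆ ∘ Y⊆) le (mono σ K) (≤-trans (≤-reflexive (size-mono σ K)) K≤)
             λ (x , Z , Z⊆ , emb) → h (x , Z , Z⊆ , Emb-mono σ K emb))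
          (λ S⊆ le sparse → kill σ V⊆ dead c∈ 0<b (X⊆ ∘ S⊆) sparse le)
          κ≤

  -- Either colour `a` has all small trees in every set of `suc (φ d A 1)` units, or some such set
  -- `X` misses one of them. Then so does every subset of `X`, `trees` provides all small trees in
  -- colour `b`, and `X` is large enough for `dominate` with `b`. The `suc` makes the number of
  -- units positive.
  bounded-suc : ∀ {r A} → Bounded (suc r) A → Bounded (suc (suc r)) (φ d A (suc (φ d A 1)))
  bounded-suc {r} {A} bounded alive D V le V⊆ dead big with 2 ≤? ∥ alive ∥
  ... | no few = bounded alive D V (≤-trans (s≤s⁻¹ (≰⇒> few)) (s≤s z≤n)) V⊆ dead
                   (≤-trans (*-monoˡ-≤ (D + q) (A≤φ d A (suc (φ d A 1)))) big)
  ... | yes many with two-elements many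
  ...   | a , b , a∈ , b∈ , a≢b =
    dominate (suc (φ d A 1)) V⊆ dead a∈ (s≤s z≤n) (λ {X} X⊆ large K K≤ noK →
      dominate 1 (V⊆ ∘ X⊆) (still dead X⊆) b∈ (s≤s z≤n)
        (λ {Y} Y⊆ large′ L L≤ noL →
          trees a≢b (V⊆ ∘ X⊆ ∘ Y⊆) (≤-trans (m≤n+m q D) (≤-trans (≤-reflexive (sym (+-identityʳ _))) large′)) K L K≤ L≤
            (noK ∘ Has-mono (along (G a)) Y⊆) noL)
        (≤-trans (m≤n+m _ (D + q)) large)) big
    where
    open Step {suc r} {A} bounded {alive} {D} le
    still : (∀ i → i ∈ alive ⊎ Dead D V i) → ∀ {X} → X ⊆ V → ∀ i → i ∈ alive ⊎ Dead D X i
    still dead X⊆ i with dead i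
    ... | inj₁ p = inj₁ p
    ... | inj₂ p = inj₂ (Dead-mono ≤-refl X⊆ p)

-- Polynomial bounds

-- A bare power without a coefficient: for `d ≥ 2`, constants and the factor 2 of a sum go into the
-- exponent.
PolyBounded : (ℕ → ℕ) → Set
PolyBounded f = ∃ λ e → ∀ {d} → 2 ≤ d → f d ≤ d ^ e

private
  1≤^ : ∀ {d} e → 2 ≤ d → 1 ≤ d ^ e
  1≤^ {d} e h = ≤-trans (≤-reflexive (sym (^-zeroˡ e))) (^-monoˡ-≤ e (≤-trans (s≤s z≤n) h))

  n<2^n : ∀ n → n < 2 ^ n
  n<2^n zero    = s≤s z≤n
  n<2^n (suc n) = +-mono-≤ (1≤^ n ≤-refl) (≤-trans (n<2^n n) (≤-reflexive (sym (+-identityʳ _))))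

poly-* : ∀ {f g} → PolyBounded f → PolyBounded g → PolyBounded (λ d → f d * g d)
poly-* (a , p) (b , q) = a + b , λ {d} h → ≤-trans (*-mono-≤ (p h) (q h)) (≤-reflexive (sym (^-distribˡ-+-* d a b)))

poly-const : ∀ c → PolyBounded (const c)
poly-const c = c , λ h → ≤-trans (<⇒≤ (n<2^n c)) (^-monoˡ-≤ c h)

poly-id : PolyBounded id
poly-id = 1 , λ {d} h → ≤-reflexive (sym (^-identityʳ d))

poly-+ : ∀ {f g} → PolyBounded f → PolyBounded g → PolyBounded (λ d → f d + g d)
poly-+ {f} {g} (a , p) (b , q) = 1 + (a + b) , λ {d} h → begin
  f d + g d                          ≤⟨ +-mono-≤ (p h) (q h) ⟩
  d ^ a + d ^ b                      ≤⟨ +-mono-≤ (widen a b h) (≤-trans (widen b a h) (≤-reflexive (cong (d ^_) (+-comm b a)))) ⟩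
  d ^ (a + b) + d ^ (a + b)          ≡⟨ cong (d ^ (a + b) +_) (sym (+-identityʳ _)) ⟩
  2 * d ^ (a + b)                    ≤⟨ *-monoˡ-≤ (d ^ (a + b)) h ⟩
  d * d ^ (a + b)                    ∎
  where
  open ≤-Reasoning
  widen : ∀ a b {d} → 2 ≤ d → d ^ a ≤ d ^ (a + b)
  widen a b {d} h = ≤-trans (≤-reflexive (sym (*-identityʳ _)))
    (≤-trans (*-monoʳ-≤ (d ^ a) (1≤^ b h)) (≤-reflexive (sym (^-distribˡ-+-* d a b))))

poly-cong : ∀ {f g} → (∀ d → f d ≡ g d) → PolyBounded g → PolyBounded f
poly-cong eq (e , p) = e , λ {d} h → ≤-trans (≤-reflexive (eq d)) (p h)

-- With d = 2 ^ (4 e) one has d ^ e ≤ 2 ^ d, because 4 e ² ≤ (2 e) ² ≤ 2 ^ (4 e).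
opaque
  exponential-wins : ∀ {f} → PolyBounded f → ∃ λ d → 2 ≤ d × f d ≤ 2 ^ d
  exponential-wins {f} (e , p) = d , 2≤d , (begin
    f d                      ≤⟨ p 2≤d ⟩
    d ^ e                    ≤⟨ ^-monoʳ-≤ d {{>-nonZero (≤-trans (s≤s z≤n) 2≤d)}} (n≤1+n e) ⟩
    d ^ E                    ≡⟨ ^-*-assoc 2 (4 * E) E ⟩
    2 ^ (4 * E * E)          ≤⟨ ^-monoʳ-≤ 2 square ⟩
    2 ^ d                    ∎)
    where
    open ≤-Reasoning
    E d : ℕ
    -- One more than `e`, so that `d ≥ 2` even if `e` is 0.
    E = suc e
    d = 2 ^ (4 * E)
    2≤d : 2 ≤ d
    2≤d = ^-monoʳ-≤ 2 {1} {4 * E} (≤-trans (s≤s z≤n) (m≤m+n E _))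
    square : 4 * E * E ≤ d
    square = begin
      4 * E * E                      ≡⟨ regroup E ⟩
      (2 * E) * (2 * E)              ≤⟨ *-mono-≤ (<⇒≤ (n<2^n (2 * E))) (<⇒≤ (n<2^n (2 * E))) ⟩
      2 ^ (2 * E) * 2 ^ (2 * E)      ≡⟨ sym (^-distribˡ-+-* 2 (2 * E) (2 * E)) ⟩
      2 ^ (2 * E + 2 * E)            ≡⟨ cong (2 ^_) (double E) ⟩
      2 ^ (4 * E)                    ∎
      where
      regroup : ∀ E → 4 * E * E ≡ (2 * E) * (2 * E)
      regroup = solve-∀
      double : ∀ E → 2 * E + 2 * E ≡ 4 * E
      double = solve-∀

threshold : ℕ → ℕ → ℕ → ℕ
threshold k zero    d = k + 2
threshold k (suc r) d = φ d (threshold k r d) (suc (φ d (threshold k r d) 1))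

poly-φ : ∀ {A α} → PolyBounded A → PolyBounded α → PolyBounded (λ d → φ d (A d) (α d))
poly-φ {A} {α} pA pα =
  poly-cong (λ d → φ-def d (A d) (α d))
    (poly-* (poly-const 2) (poly-* (poly-const 2) (poly-* pA (poly-+ (poly-const 1) (poly-* (poly-const 2) (poly-* (poly-const 4) poly-ω))))))
  where
  β : PolyBounded (λ d → α d + 2 * d)
  β = poly-+ pα (poly-* (poly-const 2) poly-id)
  poly-ω : PolyBounded (λ d → ω d (A d) (α d))
  poly-ω = poly-cong (λ d → ω-def d (A d) (α d))
    (poly-+ (poly-+ (poly-* poly-id (poly-* (poly-const 2) (poly-* pA (poly-+ (poly-const 1) (poly-* (poly-const 2) β))))) β) (poly-const 1))

poly-threshold : ∀ k r → PolyBounded (threshold k r)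
poly-threshold k zero    = poly-const (k + 2)
poly-threshold k (suc r) = poly-φ (poly-threshold k r) (poly-+ (poly-const 1) (poly-φ (poly-threshold k r) (poly-const 1)))

-- Sums of products of all but one factor

∏ : ∀ {k} → (Fin k → ℕ) → ℕ
∏ {zero}  n = 1
∏ {suc k} n = n zero * ∏ (n ∘ suc)

-- This is `∏ n` times the sum of the reciprocals, the right-hand side of the theorem up to the
-- constant; the combinatorial argument thus stays within ℕ.
cofactors : ∀ {k} → (Fin k → ℕ) → ℕ
cofactors {zero}  n = 0
cofactors {suc k} n = ∏ (n ∘ suc) + n zero * cofactors (n ∘ suc)

∏-punchIn : ∀ {k} (n : Fin (suc k) → ℕ) i → ∏ n ≡ n i * ∏ (n ∘ punchIn i)
∏-punchIn n zero = refl
∏-punchIn {suc k} n (suc i) =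
  trans (cong (n zero *_) (∏-punchIn (n ∘ suc) i)) (exchange (n zero) (n (suc i)) _)
  where
  exchange : ∀ a b c → a * (b * c) ≡ b * (a * c)
  exchange = solve-∀

cofactors-punchIn : ∀ {k} (n : Fin (suc k) → ℕ) i →
                    cofactors n ≡ ∏ (n ∘ punchIn i) + n i * cofactors (n ∘ punchIn i)
cofactors-punchIn n zero = refl
cofactors-punchIn {suc k} n (suc i) =
  trans (cong₂ (λ x y → x + n zero * y) (∏-punchIn (n ∘ suc) i) (cofactors-punchIn (n ∘ suc) i))
        (exchange (n zero) (n (suc i)) _ _)
  where
  exchange : ∀ a b P C → b * P + a * (P + b * C) ≡ a * P + b * (P + a * C)
  exchange = solve-∀

∏-mono : ∀ {k} {m n : Fin k → ℕ} → (∀ i → m i ≤ n i) → ∏ m ≤ ∏ n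
∏-mono {zero}  h = ≤-refl
∏-mono {suc k} h = *-mono-≤ (h zero) (∏-mono (h ∘ suc))

cofactors-mono : ∀ {k} {m n : Fin k → ℕ} → (∀ i → m i ≤ n i) → cofactors m ≤ cofactors n
cofactors-mono {zero}  h = ≤-refl
cofactors-mono {suc k} h = +-mono-≤ (∏-mono (h ∘ suc)) (*-mono-≤ (h zero) (cofactors-mono (h ∘ suc)))

1≤∏ : ∀ {k} {n : Fin k → ℕ} → (∀ i → 1 ≤ n i) → 1 ≤ ∏ n
1≤∏ {zero}  h = ≤-refl
1≤∏ {suc k} h = *-mono-≤ (h zero) (1≤∏ (h ∘ suc))

≤∏ : ∀ {k} {n : Fin k → ℕ} → (∀ i → 1 ≤ n i) → ∀ i → n i ≤ ∏ n
≤∏ {suc k} {n} h i = ≤-trans (≤-reflexive (sym (*-identityʳ (n i))))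
  (≤-trans (*-monoʳ-≤ (n i) (1≤∏ (h ∘ punchIn i))) (≤-reflexive (sym (∏-punchIn n i))))

-- As there are at least two factors, some term omits a factor other than `n i` and so contains
-- `n i`.
≤cofactors : ∀ {k} {n : Fin (2 + k) → ℕ} → (∀ i → 1 ≤ n i) → ∀ i → n i ≤ cofactors n
≤cofactors {k} {n} h i = begin
  n i                                                        ≡⟨ cong n (sym (punchIn-punchOut j≢i)) ⟩
  n (punchIn j (punchOut j≢i))                               ≤⟨ ≤∏ (h ∘ punchIn j) (punchOut j≢i) ⟩
  ∏ (n ∘ punchIn j)                                          ≤⟨ m≤m+n _ _ ⟩
  ∏ (n ∘ punchIn j) + n j * cofactors (n ∘ punchIn j)        ≡⟨ sym (cofactors-punchIn n j) ⟩
  cofactors n                                                ∎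
  where
  open ≤-Reasoning
  j : Fin (2 + k)
  j = punchIn i zero
  j≢i : j ≢ i
  j≢i = punchInᵢ≢i i zero

-- Every term of cofactors contains one of the two factors that shrink.
cofactors-shrink : ∀ {k} {m n : Fin k → ℕ} {a b c} → a ≢ b → (∀ i → m i ≤ n i) →
                   m a * c ≤ n a → m b * c ≤ n b → cofactors m * c ≤ cofactors n
cofactors-shrink {suc k} {m} {n} {a} {b} {c} a≢b le la lb = begin
  cofactors m * c                                            ≡⟨ cong (_* c) (cofactors-punchIn m a) ⟩
  (∏ m′ + m a * cofactors m′) * c                            ≡⟨ regroup (∏ m′) (m a) (cofactors m′) c ⟩
  ∏ m′ * c + m a * c * cofactors m′                          ≤⟨ +-mono-≤ (shrink m′ (n ∘ punchIn a) b′ lb′ (le ∘ punchIn a)) (*-mono-≤ la (cofactors-mono (le ∘ punchIn a))) ⟩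
  ∏ (n ∘ punchIn a) + n a * cofactors (n ∘ punchIn a)        ≡⟨ sym (cofactors-punchIn n a) ⟩
  cofactors n                                                ∎
  where
  open ≤-Reasoning
  m′ : Fin k → ℕ
  m′ = m ∘ punchIn a
  b′ : Fin k
  b′ = punchOut a≢b
  regroup : ∀ p x r c → (p + x * r) * c ≡ p * c + x * c * r
  regroup = solve-∀
  lb′ : m′ b′ * c ≤ n (punchIn a b′)
  lb′ = subst (λ i → m i * c ≤ n i) (sym (punchIn-punchOut a≢b)) lb
  shrink : ∀ {k} (m n : Fin k → ℕ) b → m b * c ≤ n b → (∀ i → m i ≤ n i) → ∏ m * c ≤ ∏ n
  shrink {suc k} m n b lb le = begin
    ∏ m * c                              ≡⟨ cong (_* c) (∏-punchIn m b) ⟩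
    m b * ∏ (m ∘ punchIn b) * c          ≡⟨ swap (m b) (∏ (m ∘ punchIn b)) c ⟩
    m b * c * ∏ (m ∘ punchIn b)          ≤⟨ *-mono-≤ lb (∏-mono (le ∘ punchIn b)) ⟩
    n b * ∏ (n ∘ punchIn b)              ≡⟨ sym (∏-punchIn n b) ⟩
    ∏ n                                  ∎
    where
    swap : ∀ x y z → x * y * z ≡ x * z * y
    swap = solve-∀

-- Long paths

greedy-path : ∀ {R : Relation N} {S m} → (∀ {x} → x ∈ S → m ≤ ∥ R x ∩ S ∥) → 0 < ∥ S ∥ → 0 < m →
              HasPath (flip R) S m
greedy-path {R = R} {S} {suc m} deg 0<S _ =
  let x , p , i , w , len = grow m (n<1+n m) in x , p , i , w , cong suc len
  where
  grow : ∀ j → j < suc m → ∃ λ x → ∃ λ p → elems (x ∷ p) ⊆ S × Path (flip R) x p × length p ≡ j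
  grow zero _ = let x , x∈ = inhabited 0<S in x , [] , insert-⊆ x∈ (⊥-elim ∘ ∈∅) , end , refl
  grow (suc j) j< =
    let x , p , i , w , len = grow j (<-trans (n<1+n j) j<)
        y , y∈ = ∥∖∥-fresh (R x ∩ S) (elems (x ∷ p))
                   (<-≤-trans (≤-<-trans (≤-trans (∥elems∥ (x ∷ p)) (≤-reflexive (cong suc len))) j<) (deg (i (∪-l ⁅⁆-i))))
    in y , x ∷ p , insert-⊆ (∩-r (∖-l y∈)) i , step (flip-i {R = R} (∩-l (∖-l y∈))) (∖-r y∈) w , cong suc len

-- If `R` has no path on `m` vertices, every set of `m + 2 * n` vertices contains the arborescences
-- of `D` in both directions. If moreover more than half of `V` had `D`-degree below `4 * w`, then
-- `R` would have out-degrees at least `m` there and a greedy path. The 25 rounds up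
-- `2 * (4 * w + m)`, which is `10 * m + 24 * n`.
path-or-tree : ∀ {R D : Relation N} {V m n t} →
               (∀ {x y} → x ∈ V → y ∈ V → x ≢ y → y ∈ R x ⊎ y ∈ D x) →
               0 < m → 0 < n → size t ≤ n → ¬ Has (along D) t V → 25 * (m + n) ≤ ∥ V ∥ → ¬¬ HasPath R V m
path-or-tree {N} {R} {D} {V} {suc m} {n} {t} cover 0<m 0<n t≤n no-tree big no-path =
  arborescences⇒trees {R = D} {V} {n} {w₀} {w} arbs (≤-reflexive refl) (≤-trans 0<n (m≤n+m n w₀)) 0<V few t t≤n no-tree
  where
  M w₀ w : ℕ
  M  = suc m
  w₀ = M + 2 * n
  w  = w₀ + n
  no-path′ : ¬ HasPath (flip R) V M
  no-path′ = no-path ∘ reverse {R = flip R}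
  arbs : ∀ σ {X} → X ⊆ V → w₀ ≤ ∥ X ∥ → ∀ t → size t ≤ n → ¬¬ Has (arb (along D σ)) t X
  arbs fwd {X} X⊆ large t t≤n k = k (arborescence-or-path {R = R} {D} {X} (λ p q → cover (X⊆ p) (X⊆ q))
    (λ (x , p , i , w) → no-path′ (x , p , X⊆ ∘ i , w)) t (≤-trans (+-mono-≤ (n≤1+n m) (*-monoʳ-≤ 2 t≤n)) large))
  arbs bwd {X} X⊆ large t t≤n k = k (arborescence-or-path {R = flip R} {flip D} {X}
    (λ p q x≢y → [ inj₁ ∘ flip-i {R = R} , inj₂ ∘ flip-i {R = D} ]′ (cover (X⊆ q) (X⊆ p) (x≢y ∘ sym)))
    (λ (x , p , i , w) → no-path (x , p , X⊆ ∘ i , w)) t (≤-trans (+-mono-≤ (n≤1+n m) (*-monoʳ-≤ 2 t≤n)) large))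
  0<V : 0 < ∥ V ∥
  0<V = ≤-trans (s≤s z≤n) big
  Few : Sub N
  Few = ⟦ (λ x → (x ∈? V) ×-dec (∥ D x ∩ V ∥ <? 4 * w)) ⟧
  few : 2 * ∥ Few ∥ ≤ ∥ V ∥
  few = ≮⇒≥ λ lt →
    let large = <⇒≤ (*-cancelˡ-< 2 _ _ (≤-<-trans (≤-trans (≤-trans (m≤m+n _ (15 * M + n)) (≤-reflexive (expand M n))) big) lt))
        x , p , i , w = greedy-path {R = R} {Few} {M} (deg large) (≤-trans (≤-trans (s≤s z≤n) (m≤n+m M (4 * w))) large) (s≤s z≤n)
    in no-path′ (x , p , proj₁ ∘ ⟦⟧-e ∘ i , w)
    where
    expand : ∀ M n → 2 * (4 * (M + 2 * n + n) + M) + (15 * M + n) ≡ 25 * (M + n)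
    expand = solve-∀
    deg : 4 * w + M ≤ ∥ Few ∥ → ∀ {x} → x ∈ Few → M ≤ ∥ R x ∩ Few ∥
    deg large {x} x∈ = +-cancelˡ-≤ (4 * w) _ _ (begin
      4 * w + M                                       ≤⟨ large ⟩
      ∥ Few ∥                                         ≤⟨ ∥∥-cover {W = ⁅ x ⁆} {(R x ∩ Few) ∪ (D x ∩ Few)} split ⟩
      ∥ ⁅ x ⁆ ∥ + ∥ (R x ∩ Few) ∪ (D x ∩ Few) ∥       ≤⟨ +-mono-≤ (≤-reflexive (∥⁅⁆∥ x)) (∥∪∥ (R x ∩ Few) (D x ∩ Few)) ⟩
      1 + (∥ R x ∩ Few ∥ + ∥ D x ∩ Few ∥)             ≡⟨ trans (cong suc (+-comm ∥ R x ∩ Few ∥ _)) refl ⟩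
      suc ∥ D x ∩ Few ∥ + ∥ R x ∩ Few ∥               ≤⟨ +-monoˡ-≤ _ (≤-<-trans (∥∥-mono λ p → ∩-i (∩-l p) (proj₁ (⟦⟧-e (∩-r p)))) (proj₂ (⟦⟧-e x∈))) ⟩
      4 * w + ∥ R x ∩ Few ∥                           ∎)
      where
      open ≤-Reasoning
      split : ∀ {y} → y ∈ Few → y ∈ ⁅ x ⁆ ⊎ y ∈ ((R x ∩ Few) ∪ (D x ∩ Few))
      split {y} y∈ with x ≟ y
      ... | yes refl = inj₁ ⁅⁆-i
      ... | no x≢y   = inj₂ ([ (λ r → ∪-l (∩-i r y∈)) , (λ r → ∪-r (∩-i r y∈)) ]′
                               (cover (proj₁ (⟦⟧-e x∈)) (proj₁ (⟦⟧-e y∈)) x≢y))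

-- The induction

-- An edge may have several colours, but has at least one.
record Avoiding (k : ℕ) : Set where
  field
    {order} : ℕ
    G      : Fin k → Relation order
    n      : Fin k → ℕ
    t      : Fin k → Tree
    t≤n    : ∀ i → size (t i) ≤ n i
    V      : Sub order
    cover  : ∀ {x y} → x ∈ V → y ∈ V → x ≢ y → ∃ λ i → y ∈ G i x
    avoids : ∀ i → ¬ Has (along (G i)) (t i) V

  1≤n : ∀ i → 1 ≤ n i
  1≤n i = ≤-trans (0<size (t i)) (t≤n i)

RamseyBound PathBound : ℕ → ℕ → Set
RamseyBound k C = 1 ≤ C × ∀ (I : Avoiding k) → let open Avoiding I in C * cofactors n ≤ ∥ V ∥ → ⊥
PathBound k c = 1 ≤ c × ∀ (I : Avoiding k) → let open Avoiding I in
  ∀ i {X} → X ⊆ V → c * cofactors n ≤ ∥ X ∥ → ¬¬ HasPath (G i) X (n i)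

levels-bound : ∀ (ℓ : Fin N → ℕ) c m {X} → (∀ l → l < m → ∥ ⟦ (λ x → (x ∈? X) ×-dec (ℓ x ℕ.≟ l)) ⟧ ∥ ≤ c) →
               (∀ {x} → x ∈ X → ℓ x < m) → ∥ X ∥ ≤ m * c
levels-bound {N} ℓ c zero h low = ≤-trans (∥∥-mono {W = ∅} (λ x∈ → ⊥-elim (n≮0 (low x∈)))) (≤-reflexive (∥∅∥ {N}))
levels-bound ℓ c (suc m) {X} h low =
  ≤-trans (∥∥-cover {W = ⟦ (λ x → (x ∈? X) ×-dec (ℓ x ℕ.≟ m)) ⟧} {⟦ (λ x → (x ∈? X) ×-dec (ℓ x <? m)) ⟧} split)
    (+-mono-≤ (h m ≤-refl)
      (levels-bound ℓ c m (λ l l< → ≤-trans (∥∥-mono λ p → let q , e = ⟦⟧-e p in ⟦⟧-i (proj₁ (⟦⟧-e q) , e)) (h l (<-trans l< (n<1+n m))))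
        (proj₂ ∘ ⟦⟧-e)))
  where
  split : ∀ {x} → x ∈ X → x ∈ ⟦ (λ x → (x ∈? X) ×-dec (ℓ x ℕ.≟ m)) ⟧ ⊎ x ∈ ⟦ (λ x → (x ∈? X) ×-dec (ℓ x <? m)) ⟧
  split {x} x∈ with ℓ x ℕ.≟ m
  ... | yes e = inj₁ (⟦⟧-i (x∈ , e))
  ... | no ne = inj₂ (⟦⟧-i (x∈ , ≤∧≢⇒< (s≤s⁻¹ (low x∈)) ne))

path-bound-two : PathBound 2 25
path-bound-two = s≤s z≤n , bound
  where
  bound : ∀ (I : Avoiding 2) → let open Avoiding I in
          ∀ i {X} → X ⊆ V → 25 * cofactors n ≤ ∥ X ∥ → ¬¬ HasPath (G i) X (n i)
  bound I i {X} X⊆ big =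
    path-or-tree {R = G i} {G j} {X} {n i} {n j} {t j} cover₂ (1≤n i) (1≤n j) (t≤n j) (avoids j ∘ Has-mono (along (G j)) X⊆)
      (≤-trans (≤-reflexive (cong (25 *_) (trans (two (n i) (n j)) (sym (cofactors-punchIn n i))))) big)
    where
    open Avoiding I
    j : Fin 2
    j = punchIn i zero
    two : ∀ a b → a + b ≡ b * 1 + a * (1 + b * 0)
    two = solve-∀
    cover₂ : ∀ {x y} → x ∈ X → y ∈ X → x ≢ y → y ∈ G i x ⊎ y ∈ G j x
    cover₂ {x} {y} p q x≢y with cover (X⊆ p) (X⊆ q) x≢y
    ... | c , r with i ≟ c
    ...   | yes refl = inj₁ r
    ...   | no i≢c with punchOut i≢c | punchIn-punchOut i≢c
    ...     | zero | eq = inj₂ (subst (λ c → y ∈ G c x) (sym eq) r)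

-- By `same-level`, no edge of colour `i` joins two vertices of a level, so a level is a smaller
-- instance with the other colours. There are fewer than `n i` levels, and `n i * cofactors n′` is
-- at most `cofactors n`.
path-bound-suc : ∀ {k C} → RamseyBound (2 + k) C → PathBound (3 + k) C
path-bound-suc {k} {C} (1≤C , ramsey) = 1≤C , bound
  where
  bound : ∀ (I : Avoiding (3 + k)) → let open Avoiding I in
          ∀ i {X} → X ⊆ V → C * cofactors n ≤ ∥ X ∥ → ¬¬ HasPath (G i) X (n i)
  bound I i {X} X⊆ big no-path with Avoiding.n I i in eq
  ... | zero = n≮0 (≤-trans (Avoiding.1≤n I i) (≤-reflexive eq))
  ... | suc m = <⇒≱ small big
    where
    open Avoiding I
    open Levels (flip (G i)) X
    ℓ : Fin order → ℕ
    ℓ = proj₁ (gallai-roy no-path)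
    supp : Supported ℓ
    supp = proj₁ (proj₂ (gallai-roy no-path))
    stable : Stable ℓ
    stable = proj₂ (proj₂ (gallai-roy no-path))
    n′ : Fin (2 + k) → ℕ
    n′ = n ∘ punchIn i
    class : ℕ → Sub order
    class l = ⟦ (λ x → (x ∈? X) ×-dec (ℓ x ℕ.≟ l)) ⟧
    class⊆ : ∀ {l} → class l ⊆ X
    class⊆ = proj₁ ∘ ⟦⟧-e
    cover′ : ∀ l {x y} → x ∈ class l → y ∈ class l → x ≢ y → ∃ λ j → y ∈ G (punchIn i j) x
    cover′ l {x} {y} p q x≢y with cover (X⊆ (class⊆ p)) (X⊆ (class⊆ q)) x≢y
    ... | j , r with i ≟ j
    ...   | yes refl = ⊥-elim (x≢y (same-level ℓ supp stable (class⊆ q) (class⊆ p) (flip-i {R = G i} r)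
                                     (trans (proj₂ (⟦⟧-e p)) (sym (proj₂ (⟦⟧-e q))))))
    ...   | no i≢j   = punchOut i≢j , subst (λ c → y ∈ G c x) (sym (punchIn-punchOut i≢j)) r
    class-small : ∀ l → ∥ class l ∥ ≤ C * cofactors n′
    class-small l = <⇒≤ (≰⇒> (ramsey (record
      { G = G ∘ punchIn i ; n = n′ ; t = t ∘ punchIn i ; t≤n = t≤n ∘ punchIn i ; V = class l
      ; cover = cover′ l ; avoids = λ j → avoids (punchIn i j) ∘ Has-mono (along (G (punchIn i j))) (X⊆ ∘ class⊆) })))
    positive : 0 < C * cofactors n′
    positive = *-mono-≤ 1≤C (≤-trans (1≤n (punchIn i zero)) (≤cofactors (1≤n ∘ punchIn i) zero))
    small : ∥ X ∥ < C * cofactors n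
    small = begin-strict
      ∥ X ∥                                      ≤⟨ levels-bound ℓ (C * cofactors n′) m (λ l _ → class-small l) (level< no-path supp) ⟩
      m * (C * cofactors n′)                     <⟨ +-monoˡ-≤ _ positive ⟩
      suc m * (C * cofactors n′)                 ≡⟨ swap (suc m) C (cofactors n′) ⟩
      C * (suc m * cofactors n′)                 ≡⟨ cong (λ a → C * (a * cofactors n′)) (sym eq) ⟩
      C * (n i * cofactors n′)                   ≤⟨ *-monoʳ-≤ C (m≤n+m _ (∏ n′)) ⟩
      C * (∏ n′ + n i * cofactors n′)            ≡⟨ cong (C *_) (sym (cofactors-punchIn n i)) ⟩
      C * cofactors n                            ∎
      where
      open ≤-Reasoning
      swap : ∀ a b c → a * (b * c) ≡ b * (a * c)
      swap = solve-∀

module _ {k c : ℕ} (path-bound : PathBound (2 + k) c)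
         (d : ℕ) (2≤d : 2 ≤ d) (threshold≤ : threshold (2 + k) (suc k) d ≤ 2 ^ d) where

  private
    K : ℕ
    K = 2 + k

    C : ℕ
    C = c * 2 ^ d

    1<2^d : 1 < 2 ^ d
    1<2^d = ^-monoʳ-≤ 2 {1} {d} (≤-trans (s≤s z≤n) 2≤d)

    instance
      2^d≢0 : NonZero (2 ^ d)
      2^d≢0 = m^n≢0 2 d

    module Round (I : Avoiding K) (recur : ∀ (J : Avoiding K) → ∑ (Avoiding.n J) < ∑ (Avoiding.n I) →
                  C * cofactors (Avoiding.n J) ≤ ∥ Avoiding.V J ∥ → ⊥) where
      open Avoiding I

      -- Large enough for the path bound, and also for the induction once two sizes are divided by
      -- `2 ^ d`, since `C` is only `c * 2 ^ d`.
      q : ℕ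
      q = c * cofactors n

      n≤q : ∀ i → n i ≤ q
      n≤q i = ≤-trans (≤cofactors 1≤n i) (≤-trans (≤-reflexive (sym (*-identityˡ _))) (*-monoˡ-≤ (cofactors n) (proj₁ path-bound)))

      paths : ∀ i σ {X} → X ⊆ V → q ≤ ∥ X ∥ → ¬¬ HasPath (along (G i) σ) X (n i)
      paths i fwd X⊆ le     = proj₂ path-bound I i X⊆ le
      paths i bwd X⊆ le not = proj₂ path-bound I i X⊆ le (not ∘ reverse)

      data Which (a b i : Fin K) : Set where
        first  : a ≡ i → Which a b i
        second : b ≡ i → Which a b i
        other  : a ≢ i → b ≢ i → Which a b i

      which : ∀ a b i → Which a b i
      which a b i with a ≟ i | b ≟ i
      ... | yes p | _     = first p
      ... | no _  | yes q = second q
      ... | no p  | no q  = other p q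

      module Shrink {a b} (a≢b : a ≢ b) (S T : Tree)
                    (S≤ : size S ≤ quotient d (n a)) (T≤ : size T ≤ quotient d (n b)) where

        m : Fin K → ℕ
        m i with which a b i
        ... | first _  = quotient d (n i)
        ... | second _ = quotient d (n i)
        ... | other _ _ = n i

        s : Fin K → Tree
        s i with which a b i
        ... | first _  = S
        ... | second _ = T
        ... | other _ _ = t i

        s≤m : ∀ i → size (s i) ≤ m i
        s≤m i with which a b i
        ... | first refl  = S≤
        ... | second refl = T≤
        ... | other _ _   = t≤n i

        m≤n : ∀ i → m i ≤ n i
        m≤n i with which a b i
        ... | first _  = m/n≤m (n i) (2 ^ d)
        ... | second _ = m/n≤m (n i) (2 ^ d)
        ... | other _ _ = ≤-refl

        m-first : m a ≡ quotient d (n a)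
        m-first with which a b a
        ... | first _   = refl
        ... | second _  = refl
        ... | other p _ = ⊥-elim (p refl)

        m-second : m b ≡ quotient d (n b)
        m-second with which a b b
        ... | first _   = refl
        ... | second _  = refl
        ... | other _ p = ⊥-elim (p refl)

        ∑m<∑n : ∑ m < ∑ n
        ∑m<∑n = ∑-mono-< m≤n a (≤-<-trans (≤-reflexive m-first) (m/n<m (n a) (2 ^ d) {{>-nonZero (1≤n a)}} 1<2^d))

        cofactors-m : C * cofactors m ≤ q
        cofactors-m = begin
          c * 2 ^ d * cofactors m      ≡⟨ swap c (2 ^ d) (cofactors m) ⟩
          c * (cofactors m * 2 ^ d)    ≤⟨ *-monoʳ-≤ c (cofactors-shrink a≢b m≤n
                                            (≤-trans (≤-reflexive (cong (_* 2 ^ d) m-first)) (m/n*n≤m (n a) (2 ^ d)))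
                                            (≤-trans (≤-reflexive (cong (_* 2 ^ d) m-second)) (m/n*n≤m (n b) (2 ^ d)))) ⟩
          c * cofactors n              ∎
          where
          open ≤-Reasoning
          swap : ∀ x y z → x * y * z ≡ x * (z * y)
          swap = solve-∀

        s-avoids : ∀ {X} → X ⊆ V → ¬ Has (along (G a)) S X → ¬ Has (along (G b)) T X → ∀ i → ¬ Has (along (G i)) (s i) X
        s-avoids X⊆ noS noT i with which a b i
        ... | first refl  = noS
        ... | second refl = noT
        ... | other _ _   = avoids i ∘ Has-mono (along (G i)) X⊆

      trees : ∀ {a b} → a ≢ b → ∀ {X} → X ⊆ V → q ≤ ∥ X ∥ → ∀ S T →
              size S ≤ quotient d (n a) → size T ≤ quotient d (n b) →
              ¬ Has (along (G a)) S X → ¬ Has (along (G b)) T X → ⊥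
      trees a≢b {X} X⊆ large S T S≤ T≤ noS noT =
        recur (record { G = G ; n = m ; t = s ; t≤n = s≤m ; V = X ; cover = λ p r → cover (X⊆ p) (X⊆ r)
                      ; avoids = s-avoids X⊆ noS noT })
              ∑m<∑n (≤-trans cofactors-m large)
        where open Shrink a≢b S T S≤ T≤

      open Colours G n t t≤n V cover d q n≤q (≤-trans (1≤n zero) (n≤q zero)) paths trees avoids

      bounded : ∀ r → Bounded (suc r) (threshold K r d)
      bounded zero    = bounded-one
      bounded (suc r) = bounded-suc (bounded r)

      contradiction : C * cofactors n ≤ ∥ V ∥ → ⊥
      -- Every colour is alive at the start, so `D` is 0 and the unit is `q`.
      contradiction big = bounded (suc k) full 0 V (≤-reflexive ∥full∥) id (λ _ → inj₁ ∈full) (begin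
        threshold K (suc k) d * q      ≤⟨ *-monoˡ-≤ q threshold≤ ⟩
        2 ^ d * (c * cofactors n)      ≡⟨ swap (2 ^ d) c (cofactors n) ⟩
        c * 2 ^ d * cofactors n        ≤⟨ big ⟩
        ∥ V ∥                          ∎)
        where
        open ≤-Reasoning
        swap : ∀ x y z → x * (y * z) ≡ y * x * z
        swap = solve-∀

    induction : ∀ s (I : Avoiding K) → let open Avoiding I in ∑ n < s → C * cofactors n ≤ ∥ V ∥ → ⊥
    induction (suc s) I lt = Round.contradiction I λ J lt′ → induction s J (<-≤-trans lt′ (s≤s⁻¹ lt))

  ramsey-step : RamseyBound K C
  ramsey-step = *-mono-≤ (proj₁ path-bound) (<⇒≤ 1<2^d) , λ I → induction _ I ≤-refl

opaque
  ramsey-bound : ∀ k → ∃ (RamseyBound (2 + k))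
  ramsey-bound k =
    let d , 2≤d , le = exponential-wins (poly-threshold (2 + k) (suc k))
    in _ , ramsey-step (proj₂ (path-bound k)) d 2≤d le
    where
    path-bound : ∀ k → ∃ (PathBound (2 + k))
    path-bound zero    = _ , path-bound-two
    path-bound (suc k) = _ , path-bound-suc (proj₂ (ramsey-bound k))

-- Trees with named vertices

-- In a `Distinct` term each label has exactly one `leaf`, so a neighbour of `x` is added by
-- rewriting that leaf, and the root stays the same.
data Labelled (N : ℕ) : Set where
  leaf : Fin N → Labelled N
  hang : Labelled N → Dir → Labelled N → Labelled N

shape : Labelled N → Tree
shape (leaf _)     = •
shape (hang t s u) = shape t ◂[ s ] shape u

root : Labelled N → Fin N
root (leaf a)     = a
root (hang t _ _) = root t

labels : Labelled N → Sub N
labels (leaf a)     = ⁅ a ⁆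
labels (hang t _ u) = labels t ∪ labels u

Distinct : Labelled N → Set
Distinct (leaf _)     = ⊤
Distinct (hang t _ u) = Distinct t × Distinct u × (∀ {a} → a ∈ labels t → a ∈ labels u → ⊥)

root∈ : ∀ (t : Labelled N) → root t ∈ labels t
root∈ (leaf a)     = ⁅⁆-i
root∈ (hang t _ u) = ∪-l (root∈ t)

size≤labels : ∀ (t : Labelled N) → Distinct t → size (shape t) ≤ ∥ labels t ∥
size≤labels (leaf a)     _           = ≤-reflexive (sym (∥⁅⁆∥ a))
size≤labels (hang t _ u) (p , q , d) = ≤-trans (+-mono-≤ (size≤labels t p) (size≤labels u q)) (∥∥-disjoint ∪-l ∪-r d)

Hom : ∀ {M} → (Dir → Relation M) → Labelled N → (Fin N → Fin M) → Set
Hom A (leaf _)     g = ⊤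
Hom A (hang t s u) g = Hom A t g × Hom A u g × g (root u) ∈ A s (g (root t))

Hom-cong : ∀ {M} {A : Dir → Relation M} (t : Labelled N) {g h} → (∀ {a} → a ∈ labels t → g a ≡ h a) → Hom A t g → Hom A t h
Hom-cong (leaf _)     eq _ = tt
Hom-cong {A = A} (hang t s u) {g} {h} eq (p , q , r) =
  Hom-cong t (eq ∘ ∪-l) p , Hom-cong u (eq ∘ ∪-r) q ,
  subst (λ y → h (root u) ∈ A s y) (eq (∪-l (root∈ t))) (subst (_∈ A s (g (root t))) (eq (∪-r (root∈ u))) r)

Emb⇒Hom : ∀ {M} {A : Dir → Relation M} (t : Labelled N) {x X} → Distinct t → Emb A (shape t) x X →
          ∃ λ g → Hom A t g × g (root t) ≡ x × (∀ {a} → a ∈ labels t → g a ∈ X) ×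
                  (∀ {a b} → a ∈ labels t → b ∈ labels t → g a ≡ g b → a ≡ b)
Emb⇒Hom (leaf a) {x} _ point =
  const x , tt , refl , (λ _ → ⁅⁆-i) , λ p q _ → trans (sym (⁅⁆-e p)) (⁅⁆-e q)
Emb⇒Hom {N} {M} {A} (hang t s u) {X = X} (dt , du , d) (graft {X = Y} {Z} e f disj r)
  with Emb⇒Hom t dt e | Emb⇒Hom u du f
... | g , g-hom , g-root , g-in , g-inj | h , h-hom , h-root , h-in , h-inj =
  both , (Hom-cong t (sym ∘ on-t) g-hom , Hom-cong u (sym ∘ on-u) h-hom , edge) ,
  trans (on-t (root∈ t)) g-root , inside , injective
  where
  both : Fin N → Fin M
  both a with a ∈? labels t
  ... | yes _ = g a
  ... | no _  = h a
  on-t : ∀ {a} → a ∈ labels t → both a ≡ g a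
  on-t {a} p with a ∈? labels t
  ... | yes _ = refl
  ... | no q  = ⊥-elim (q p)
  on-u : ∀ {a} → a ∈ labels u → both a ≡ h a
  on-u {a} p with a ∈? labels t
  ... | yes q = ⊥-elim (d q p)
  ... | no _  = refl
  edge : both (root u) ∈ A s (both (root t))
  edge = subst (λ y → both (root u) ∈ A s y) (sym (trans (on-t (root∈ t)) g-root))
           (subst (_∈ A s _) (sym (trans (on-u (root∈ u)) h-root)) r)
  in-t : ∀ {a} → a ∈ labels t → both a ∈ Y
  in-t p = subst (_∈ Y) (sym (on-t p)) (g-in p)
  in-u : ∀ {a} → a ∈ labels u → both a ∈ Z
  in-u p = subst (_∈ Z) (sym (on-u p)) (h-in p)
  inside : ∀ {a} → a ∈ labels t ∪ labels u → both a ∈ Y ∪ Z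
  inside p = [ ∪-l ∘ in-t , ∪-r ∘ in-u ]′ (∪-e p)
  injective : ∀ {a b} → a ∈ labels t ∪ labels u → b ∈ labels t ∪ labels u → both a ≡ both b → a ≡ b
  injective p q eq with ∪-e p | ∪-e q
  ... | inj₁ p | inj₁ q = g-inj p q (trans (sym (on-t p)) (trans eq (on-t q)))
  ... | inj₂ p | inj₂ q = h-inj p q (trans (sym (on-u p)) (trans eq (on-u q)))
  ... | inj₁ p | inj₂ q = ⊥-elim (disj (subst (_∈ Y) eq (in-t p)) (in-u q))
  ... | inj₂ p | inj₁ q = ⊥-elim (disj (subst (_∈ Y) (sym eq) (in-t q)) (in-u p))

module AddLeaf {N : ℕ} (x : Fin N) (s : Dir) (y : Fin N) where

  add : Labelled N → Labelled N
  add (leaf a) with x ≟ a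
  ... | yes _ = hang (leaf a) s (leaf y)
  ... | no _  = leaf a
  add (hang t r u) = hang (add t) r (add u)

  root-add : ∀ t → root (add t) ≡ root t
  root-add (leaf a) with x ≟ a
  ... | yes _ = refl
  ... | no _  = refl
  root-add (hang t _ _) = root-add t

  old : ∀ t {a} → a ∈ labels t → a ∈ labels (add t)
  old (leaf a) p with x ≟ a
  ... | yes _ = ∪-l p
  ... | no _  = p
  old (hang t _ u) p = [ ∪-l ∘ old t , ∪-r ∘ old u ]′ (∪-e p)

  new : ∀ t → x ∈ labels t → y ∈ labels (add t)
  new (leaf a) p with x ≟ a
  ... | yes _  = ∪-r ⁅⁆-i
  ... | no x≢a = ⊥-elim (x≢a (sym (⁅⁆-e p)))
  new (hang t _ u) p = [ ∪-l ∘ new t , ∪-r ∘ new u ]′ (∪-e p)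

  added : ∀ t {a} → a ∈ labels (add t) → a ∈ labels t ⊎ (y ≡ a × x ∈ labels t)
  added (leaf b) p with x ≟ b
  ... | yes refl = [ inj₁ , (λ q → inj₂ (⁅⁆-e q , ⁅⁆-i)) ]′ (∪-e p)
  ... | no _     = inj₁ p
  added (hang t _ u) p with ∪-e p
  ... | inj₁ q = [ inj₁ ∘ ∪-l , (λ (e , r) → inj₂ (e , ∪-l r)) ]′ (added t q)
  ... | inj₂ q = [ inj₁ ∘ ∪-r , (λ (e , r) → inj₂ (e , ∪-r r)) ]′ (added u q)

  distinct : ∀ t → y ∉ labels t → Distinct t → Distinct (add t)
  distinct (leaf a) y∉ _ with x ≟ a
  ... | yes _ = tt , tt , λ p q → y∉ (subst (_∈ ⁅ a ⁆) (sym (⁅⁆-e q)) p)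
  ... | no _  = tt
  distinct (hang t _ u) y∉ (p , q , d) = distinct t (y∉ ∘ ∪-l) p , distinct u (y∉ ∘ ∪-r) q , disjoint
    where
    disjoint : ∀ {a} → a ∈ labels (add t) → a ∈ labels (add u) → ⊥
    disjoint p q with added t p | added u q
    ... | inj₁ p          | inj₁ q          = d p q
    ... | inj₁ p          | inj₂ (refl , _) = y∉ (∪-l p)
    ... | inj₂ (refl , _) | inj₁ q          = y∉ (∪-r q)
    ... | inj₂ (_ , p)    | inj₂ (_ , q)    = d p q

  module _ {M} {A : Dir → Relation M} {g : Fin N → Fin M} where

    Hom-old : ∀ t → Hom A (add t) g → Hom A t g
    Hom-old (leaf a)     _           = tt
    Hom-old (hang t r u) (p , q , e) =
      Hom-old t p , Hom-old u q , subst (λ c → g (root u) ∈ A r (g c)) (root-add t)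
                                    (subst (λ c → g c ∈ A r (g (root (add t)))) (root-add u) e)

    Hom-new : ∀ t → x ∈ labels t → Hom A (add t) g → g y ∈ A s (g x)
    Hom-new (leaf a) x∈ h with x ≟ a
    ... | yes refl = proj₂ (proj₂ h)
    ... | no x≢a   = ⊥-elim (x≢a (sym (⁅⁆-e x∈)))
    Hom-new (hang t _ u) x∈ (p , q , _) = [ (λ x∈ → Hom-new t x∈ p) , (λ x∈ → Hom-new u x∈ q) ]′ (∪-e x∈)

-- Cycles from paths

nth : Fin N → (p : List (Fin N)) → Fin (suc (length p)) → Fin N
nth x p       zero    = x
nth x (y ∷ p) (suc i) = nth y p i

last : Fin N → List (Fin N) → Fin N
last x []      = x
last x (y ∷ p) = last y p

nth∈ : ∀ (x : Fin N) p i → nth x p i ∈ elems (x ∷ p)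
nth∈ x p       zero    = ∪-l ⁅⁆-i
nth∈ x (y ∷ p) (suc i) = ∪-r (nth∈ y p i)

nth-injective : ∀ {R : Relation N} {x p} → Path R x p → ∀ i j → nth x p i ≡ nth x p j → i ≡ j
nth-injective w zero zero _ = refl
nth-injective (step {y = y} {p} _ x∉ w) zero (suc j) eq = ⊥-elim (x∉ (subst (_∈ _) (sym eq) (nth∈ y p j)))
nth-injective (step {y = y} {p} _ x∉ w) (suc i) zero eq = ⊥-elim (x∉ (subst (_∈ _) eq (nth∈ y p i)))
nth-injective (step _ _ w) (suc i) (suc j) eq = cong suc (nth-injective w i j eq)

nth-step : ∀ {R : Relation N} {x p} → Path R x p → ∀ i → nth x p (suc i) ∈ R (nth x p (inject₁ i))
nth-step (step r _ _) zero    = r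
nth-step (step _ _ w) (suc i) = nth-step w i

nth-last : ∀ (x : Fin N) p → nth x p (fromℕ (length p)) ≡ last x p
nth-last x []      = refl
nth-last x (y ∷ p) = nth-last y p

cycle : ∀ {R : Relation N} {Adj : Fin N → Fin N → Set} → (∀ {x y} → y ∈ R x → Adj x y) →
        ∀ {x y z p} → Path R x (y ∷ z ∷ p) → x ∈ R (last z p) → Cycle Adj
cycle {R = R} adj {x} {y} {z} {p} w close = record
  { m = length p ; v = nth x (y ∷ z ∷ p) ; injective = nth-injective w _ _
  ; step = λ i → adj (nth-step w i)
  ; close = adj (subst (λ c → x ∈ R c) (sym (nth-last z p)) close) }

snoc : ∀ {R : Relation N} {x p y} → Path R x p → y ∈ R (last x p) → y ∉ elems (x ∷ p) →
       ∃ λ p′ → Path R x p′ × last x p′ ≡ y × elems (x ∷ p′) ⊆ elems (x ∷ p) ∪ ⁅ y ⁆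
snoc {x = x} {y = y} end r y∉ =
  y ∷ [] , step r (λ q → [ (λ e → y∉ (subst (_∈ _) (sym (⁅⁆-e e)) (∪-l ⁅⁆-i))) , ∈∅ ]′ (∪-e q)) end , refl ,
  insert-⊆ (∪-l (∪-l ⁅⁆-i)) (insert-⊆ (∪-r ⁅⁆-i) (⊥-elim ∘ ∈∅))
snoc {x = x} {y = y} (step r x∉ w) r′ y∉ with snoc w r′ (y∉ ∘ ∪-r)
... | p′ , w′ , eq , i =
  _ , step r (λ q → [ x∉ , (λ e → y∉ (subst (_∈ _) (sym (⁅⁆-e e)) (∪-l ⁅⁆-i))) ]′ (∪-e (i q))) w′ , eq ,
  insert-⊆ (∪-l (∪-l ⁅⁆-i)) (λ q → [ ∪-l ∘ ∪-r , ∪-r ]′ (∪-e (i q)))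

-- An oriented tree is grown from a vertex by adding leaves: a second neighbour of the new
-- vertex among the old ones would close a cycle.
module Growth (T : OrientedTree) where
  open OrientedTree T

  E S : Relation order
  E x = ⟦ edge? x ⟧
  S x = E x ∪ flip E x

  S-sym : ∀ {x y} → y ∈ S x → x ∈ S y
  S-sym {x} {y} p = [ ∪-r ∘ flip-i {R = E} , (λ (⟨ h ⟩) → ∪-l ⟨ h ⟩) ]′ (∪-e p)

  adj : ∀ {x y} → y ∈ S x → SymClosure Edge x y
  adj {x} {y} p = [ Sym.fwd ∘ ⟦⟧-e {P? = edge? x} , (λ (⟨ h ⟩) → Sym.bwd (⟦⟧-e {P? = edge? y} ⟨ h ⟩)) ]′ (∪-e p)

  record Grown (t : Labelled order) : Set where
    field
      distinct : Distinct t
      joined   : ∀ {a b} → a ∈ labels t → b ∈ labels t →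
                 ∃ λ p → Path S a p × last a p ≡ b × elems (a ∷ p) ⊆ labels t
      -- The term records all edges between its labels; maps express this without an edge relation
      -- on terms.
      complete : ∀ {M} {R : Relation M} {g} → Hom (along R) t g →
                 ∀ {a b} → a ∈ labels t → b ∈ labels t → Edge a b → g b ∈ R (g a)

  single : ∀ x → Grown (leaf x)
  single x = record
    { distinct = tt
    ; joined = λ p q → [] , end , trans (sym (⁅⁆-e p)) (⁅⁆-e q) , insert-⊆ p (⊥-elim ∘ ∈∅)
    ; complete = λ _ p q e → ⊥-elim (loopless (trans (sym (⁅⁆-e p)) (⁅⁆-e q)) e) }

  Oriented : Dir → Fin order → Fin order → Set
  Oriented s x y = (s ≡ fwd × Edge x y) ⊎ (s ≡ bwd × Edge y x)

  orientation : ∀ {x y} → SymClosure Edge x y → ∃ λ s → Oriented s x y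
  orientation (Sym.fwd e) = fwd , inj₁ (refl , e)
  orientation (Sym.bwd e) = bwd , inj₂ (refl , e)

  inward : ∀ {M} {R : Relation M} {g : Fin order → Fin M} {s x y} →
           Oriented s x y → Edge y x → g y ∈ along R s (g x) → g x ∈ R (g y)
  inward (inj₁ (refl , e′)) e _     = ⊥-elim (unidirected e e′)
  inward (inj₂ (refl , _))  _ ⟨ r ⟩ = ⟨ r ⟩

  outward : ∀ {M} {R : Relation M} {g : Fin order → Fin M} {s x y} →
            Oriented s x y → Edge x y → g y ∈ along R s (g x) → g y ∈ R (g x)
  outward (inj₁ (refl , _))  _ r = r
  outward (inj₂ (refl , e′)) e _ = ⊥-elim (unidirected e e′)

  grow : ∀ {t x y s} → Grown t → x ∈ labels t → y ∉ labels t → y ∈ S x → Oriented s x y →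
         ∃ λ t′ → Grown t′ × suc ∥ labels t ∥ ≤ ∥ labels t′ ∥
  grow {t} {x} {y} {s} grown x∈ y∉ y∈S oriented = add t , record
    { distinct = AddLeaf.distinct x s y t y∉ distinct ; joined = joined′ ; complete = complete′ } , larger
    where
    open Grown grown
    open AddLeaf x s y hiding (distinct)
    lonely : ∀ {b} → b ∈ labels t → b ∈ S y → x ≡ b
    lonely {b} b∈ b∈S with joined x∈ b∈
    ... | []    , _ , eq , _ = eq
    ... | z ∷ p , w , eq , i =
      ⊥-elim (acyclic (cycle adj (step (S-sym y∈S) (y∉ ∘ i) w) (subst (λ c → y ∈ S c) (sym eq) (S-sym b∈S))))
    larger : suc ∥ labels t ∥ ≤ ∥ labels (add t) ∥
    larger = subst (λ c → c + ∥ labels t ∥ ≤ ∥ labels (add t) ∥) (∥⁅⁆∥ y)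
      (∥∥-disjoint (λ p → subst (_∈ labels (add t)) (⁅⁆-e p) (new t x∈)) (old t) λ p q → y∉ (subst (_∈ labels t) (sym (⁅⁆-e p)) q))
    joined′ : ∀ {a b} → a ∈ labels (add t) → b ∈ labels (add t) →
              ∃ λ p → Path S a p × last a p ≡ b × elems (a ∷ p) ⊆ labels (add t)
    joined′ p q with added t p | added t q
    ... | inj₁ p | inj₁ q = let r , w , eq , i = joined p q in r , w , eq , old t ∘ i
    ... | inj₂ (refl , _) | inj₂ (refl , _) = [] , end , refl , insert-⊆ (new t x∈) (⊥-elim ∘ ∈∅)
    ... | inj₂ (refl , _) | inj₁ q =
      let r , w , eq , i = joined x∈ q
      in x ∷ r , step (S-sym y∈S) (y∉ ∘ i) w , eq , insert-⊆ (new t x∈) (old t ∘ i)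
    ... | inj₁ p | inj₂ (refl , _) =
      let r , w , eq , i = joined p x∈
          r′ , w′ , eq′ , i′ = snoc w (subst (λ c → y ∈ S c) (sym eq) y∈S) (y∉ ∘ i)
      in r′ , w′ , eq′ , λ z∈ → [ old t ∘ i , (λ e → subst (_∈ labels (add t)) (⁅⁆-e e) (new t x∈)) ]′ (∪-e (i′ z∈))
    complete′ : ∀ {M} {R : Relation M} {g} → Hom (along R) (add t) g →
                ∀ {a b} → a ∈ labels (add t) → b ∈ labels (add t) → Edge a b → g b ∈ R (g a)
    complete′ {R = R} {g} h p q e with added t p | added t q
    ... | inj₁ p | inj₁ q = complete (Hom-old t h) p q e
    ... | inj₂ (refl , _) | inj₂ (refl , _) = ⊥-elim (loopless refl e)
    ... | inj₂ (refl , _) | inj₁ q with lonely q (∪-l (⟦⟧-i e))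
    ...   | refl = inward {R = R} {g} oriented e (Hom-new {A = along R} {g} t x∈ h)
    complete′ {R = R} {g} h _ _ e | inj₁ p | inj₂ (refl , _) with lonely p (∪-r (flip-i {R = E} (⟦⟧-i e)))
    ...   | refl = outward {R = R} {g} oriented e (Hom-new {A = along R} {g} t x∈ h)

  spanning : ∀ fuel t → Grown t → order ≤ ∥ labels t ∥ + fuel → ∃ λ t → Grown t × (∀ a → a ∈ labels t)
  spanning fuel t grown b with any? (λ x → any? λ y → (x ∈? labels t) ×-dec (¬? (y ∈? labels t) ×-dec (y ∈? S x)))
  spanning fuel t grown b | no closed = t , grown , λ a → reach (connected (root t) a) (root∈ t)
    where
    reach : ∀ {a b} → Star (SymClosure Edge) a b → a ∈ labels t → b ∈ labels t
    reach ε p = p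
    reach {a} (_◅_ {j = c} e w) p with c ∈? labels t
    ... | yes q = reach w q
    ... | no q  = ⊥-elim (closed (a , c , p , q , neighbour e))
      where
      neighbour : SymClosure Edge a c → c ∈ S a
      neighbour (Sym.fwd e) = ∪-l (⟦⟧-i e)
      neighbour (Sym.bwd e) = ∪-r (flip-i {R = E} (⟦⟧-i e))
  spanning zero t grown b | yes (x , y , x∈ , y∉ , r) =
    let t′ , _ , larger = grow grown x∈ y∉ r (proj₂ (orientation (adj r)))
    in ⊥-elim (<⇒≱ larger (≤-trans (≤-trans (∥∥-mono (λ _ → ∈full)) (≤-reflexive ∥full∥)) (≤-trans b (≤-reflexive (+-identityʳ _)))))
  spanning (suc fuel) t grown b | yes (x , y , x∈ , y∉ , r) =
    let t′ , grown′ , larger = grow grown x∈ y∉ r (proj₂ (orientation (adj r)))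
    in spanning fuel t′ grown′ (≤-trans b (≤-trans (≤-reflexive (+-suc _ fuel)) (+-monoˡ-≤ fuel larger)))

rooted : ∀ (T : OrientedTree) → ∃ λ t → size t ≤ OrientedTree.order T ×
         (∀ (H : Digraph) {U} → Has (along (λ x → ⟦ Digraph.edge? H x ⟧)) t U → Copy (OrientedTree.digraph T) H)
rooted T = shape t , ≤-trans (size≤labels t distinct) (≤-trans (∥∥-mono (λ _ → ∈full)) (≤-reflexive ∥full∥)) , copy
  where
  open Growth T
  open OrientedTree T using (digraph; order; nonempty)
  start : ∀ {n} → NonZero n → Fin n
  start {suc _} _ = zero
  whole : ∃ λ t → Grown t × (∀ a → a ∈ labels t)
  whole = spanning order (leaf (start nonempty)) (single (start nonempty)) (m≤n+m order _)
  t : Labelled order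
  t = proj₁ whole
  open Grown (proj₁ (proj₂ whole))
  copy : ∀ (H : Digraph) {U} → Has (along (λ x → ⟦ Digraph.edge? H x ⟧)) (shape t) U → Copy digraph H
  copy H (x , X , _ , e) with Emb⇒Hom t distinct e
  ... | g , hom , _ , _ , injective = record
    { embed = g
    ; injective = injective (proj₂ (proj₂ whole) _) (proj₂ (proj₂ whole) _)
    ; preserves = λ {a} {b} ab → ⟦⟧-e {P? = Digraph.edge? H (g a)} (complete hom (proj₂ (proj₂ whole) a) (proj₂ (proj₂ whole) b) ab) }

-- Ramsey numbers exist because Arrows is decidable

-- A function agrees with its head and tail put together only pointwise, so predicates must respect
-- `_~_`, which takes the place of equality.
Searchable : {A : Set} → (A → A → Set) → Set₁
Searchable {A} _~_ = ∀ {P : A → Set} → (∀ {a b} → a ~ b → P a → P b) → (∀ a → Dec (P a)) → Dec (∃ P)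

search-functions : ∀ {A : Set} {_~_ : A → A → Set} → (∀ {a} → a ~ a) → Searchable _~_ → ∀ m →
                   Searchable {Fin m → A} (λ f g → ∀ i → f i ~ g i)
search-functions {A} rfl search zero {P} resp dec = map′ (λ p → empty , p) (λ (f , p) → resp (λ ()) p) (dec empty)
  where
  empty : Fin 0 → A
  empty ()
search-functions {A} {_~_} rfl search (suc m) {P} resp dec =
  map′ (λ (a , f , p) → cons a f , p) (λ (f , p) → f zero , f ∘ suc , resp (η f) p)
    (search {λ a → ∃ λ f → P (cons a f)}
       (λ a~b (f , p) → f , resp (λ { zero → a~b ; (suc i) → rfl }) p)
       (λ a → search-functions rfl search m {λ f → P (cons a f)}
                (λ f~g → resp (λ { zero → rfl ; (suc i) → f~g i })) (λ f → dec (cons a f))))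
  where
  cons : A → (Fin m → A) → Fin (suc m) → A
  cons a f zero    = a
  cons a f (suc i) = f i
  η : ∀ f i → f i ~ cons (f zero) (f ∘ suc) i
  η f zero    = rfl
  η f (suc i) = rfl

search-Fin : ∀ {n} → Searchable {Fin n} _≡_
search-Fin _ dec = any? dec

copy? : ∀ G H → Dec (Copy G H)
copy? G H =
  map′ (λ (f , inj , pre) → record { embed = f ; injective = λ {x} {y} → inj x y ; preserves = λ {x} {y} → pre x y })
       (λ c → Copy.embed c , (λ x y → Copy.injective c) , (λ x y → Copy.preserves c))
       (search-functions refl search-Fin _
         {λ f → (∀ x y → f x ≡ f y → x ≡ y) × (∀ x y → G.Edge x y → H.Edge (f x) (f y))}
         (λ {f} {g} eq (inj , pre) →
            (λ x y e → inj x y (trans (eq x) (trans e (sym (eq y))))) ,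
            (λ x y e → subst (λ v → H.Edge v (g y)) (eq x) (subst (H.Edge (f x)) (eq y) (pre x y e))))
         (λ f → all? (λ x → all? λ y → (f x ≟ f y) →-dec (x ≟ y)) ×-dec
                all? (λ x → all? λ y → G.edge? x y →-dec H.edge? (f x) (f y))))
  where
  module G = Digraph G
  module H = Digraph H

Table : ℕ → ℕ → Set
Table n k = Fin n → Fin n → Fin k

colour : ∀ {n k} → Table n k → Colouring n k
colour τ x y _ = τ x y

recolour : ∀ {n k} {c c′ : Colouring n k} {i G} → (∀ x y (x≢y : x ≢ y) → c x y x≢y ≡ c′ x y x≢y) →
           Copy G (colourClass c i) → Copy G (colourClass c′ i)
recolour eq copy = record
  { embed = embed ; injective = injective
  ; preserves = λ e → let x≢y , r = preserves e in x≢y , trans (sym (eq _ _ x≢y)) r }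
  where open Copy copy

arrows? : ∀ {k} n (G : Fin (suc k) → Digraph) → Dec (Arrows n G)
arrows? {k} n G = map′ sound complete (¬? (search-functions (λ _ → refl) (search-functions refl search-Fin n) n bad-resp bad?))
  where
  Bad : Table n (suc k) → Set
  Bad τ = ¬ ∃ λ i → Copy (G i) (colourClass (colour τ) i)
  bad-resp : ∀ {τ τ′ : Table n (suc k)} → (∀ x y → τ x y ≡ τ′ x y) → Bad τ → Bad τ′
  bad-resp eq bad (i , copy) = bad (i , recolour (λ x y _ → sym (eq x y)) copy)
  good? : ∀ (c : Colouring n (suc k)) → Dec (∃ λ i → Copy (G i) (colourClass c i))
  good? c = any? λ i → copy? (G i) (colourClass c i)
  bad? : ∀ τ → Dec (Bad τ)
  bad? τ = ¬? (good? (colour τ))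
  sound : ¬ ∃ Bad → Arrows n G
  sound none c with good? c
  ... | yes good = good
  ... | no bad   = ⊥-elim (none (table , λ (i , copy) → bad (i , recolour agree copy)))
    where
    table : Table n (suc k)
    table x y with x ≟ y
    -- A table also needs values on the diagonal, where there is no edge; any colour serves.
    ... | yes _  = zero
    ... | no x≢y = c x y x≢y
    agree : ∀ x y (x≢y : x ≢ y) → table x y ≡ c x y x≢y
    agree x y x≢y with x ≟ y
    ... | yes x≡y = ⊥-elim (x≢y x≡y)
    ... | no _    = refl
  complete : Arrows n G → ¬ ∃ Bad
  complete arrows (τ , bad) = bad (arrows (colour τ))

least : ∀ {P : ℕ → Set} → (∀ n → Dec (P n)) → ∀ {n} → P n → ∃ λ r → (P r × (∀ m → P m → r ≤ m)) × r ≤ n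
least {P} P? {n} p = search n 0 ≤-refl (λ m ()) 
  where
  search : ∀ fuel r → n ≤ r + fuel → (∀ m → m < r → ¬ P m) → ∃ λ r → (P r × (∀ m → P m → r ≤ m)) × r ≤ n
  search fuel r b below with P? r
  ... | yes q = r , (q , λ m pm → ≮⇒≥ λ m<r → below m m<r pm) , ≮⇒≥ λ n<r → below n n<r p
  search zero r b below | no ¬q with m≤n⇒m<n∨m≡n (≤-trans b (≤-reflexive (+-identityʳ r)))
  ... | inj₁ n<r  = ⊥-elim (below n n<r p)
  ... | inj₂ refl = ⊥-elim (¬q p)
  search (suc fuel) r b below | no ¬q =
    search fuel (suc r) (≤-trans b (≤-reflexive (+-suc r fuel))) λ m m<sr pm →
      case m≤n⇒m<n∨m≡n (s≤s⁻¹ m<sr) of λ where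
        (inj₁ m<r)  → below m m<r pm
        (inj₂ refl) → ¬q pm

-- Decidability of `Copy` turns the contradiction supplied by `RamseyBound` into an actual copy.
ramsey-arrows : ∀ {k C} → RamseyBound (2 + k) C → (T : Fin (2 + k) → OrientedTree) →
                Arrows (C * cofactors (OrientedTree.order ∘ T)) (OrientedTree.digraph ∘ T)
ramsey-arrows {k} {C} (_ , bound) T c with any? (λ i → copy? (OrientedTree.digraph (T i)) (colourClass c i))
... | yes copy = copy
... | no none  = ⊥-elim (bound (record
  { G = λ i x → ⟦ Digraph.edge? (colourClass c i) x ⟧
  ; n = OrientedTree.order ∘ T
  ; t = λ i → proj₁ (rooted (T i))
  ; t≤n = λ i → proj₁ (proj₂ (rooted (T i)))
  ; V = full
  ; cover = λ {x} {y} _ _ x≢y → c x y x≢y , ⟦⟧-i {P? = Digraph.edge? (colourClass c (c x y x≢y)) x} (x≢y , refl)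
  ; avoids = λ i has → none (i , proj₂ (proj₂ (rooted (T i))) (colourClass c i) has) })
  (≤-reflexive (sym ∥full∥)))

-- The bound as a rational number

open ℤ using (+_)

_/1 : ℕ → ℚ
n /1 = + n ℚ./ 1

toℚᵘ-/1 : ∀ n → ℚ.toℚᵘ (n /1) ℚᵘ.≃ ℚᵘ.mkℚᵘ (+ n) 0
toℚᵘ-/1 n = ℚₚ.toℚᵘ-fromℚᵘ (ℚᵘ.mkℚᵘ (+ n) 0)

/1-+ : ∀ a b → (a + b) /1 ≡ a /1 ℚ.+ b /1
/1-+ a b = ℚₚ.toℚᵘ-injective (begin
  ℚ.toℚᵘ ((a + b) /1)                            ≈⟨ toℚᵘ-/1 (a + b) ⟩
  ℚᵘ.mkℚᵘ (+ (a + b)) 0                          ≈⟨ ℚᵘ.*≡* (cong (ℤ._* + 1) (sym (cong₂ ℤ._+_ (ℤₚ.*-identityʳ (+ a)) (ℤₚ.*-identityʳ (+ b))))) ⟩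
  ℚᵘ.mkℚᵘ (+ a) 0 ℚᵘ.+ ℚᵘ.mkℚᵘ (+ b) 0           ≈⟨ ℚᵘₚ.+-cong (ℚᵘₚ.≃-sym (toℚᵘ-/1 a)) (ℚᵘₚ.≃-sym (toℚᵘ-/1 b)) ⟩
  ℚ.toℚᵘ (a /1) ℚᵘ.+ ℚ.toℚᵘ (b /1)               ≈⟨ ℚᵘₚ.≃-sym (ℚₚ.toℚᵘ-homo-+ (a /1) (b /1)) ⟩
  ℚ.toℚᵘ (a /1 ℚ.+ b /1)                         ∎)
  where open import Relation.Binary.Reasoning.Setoid ℚᵘₚ.≃-setoid

/1-* : ∀ a b → (a * b) /1 ≡ a /1 ℚ.* b /1
/1-* a b = ℚₚ.toℚᵘ-injective (begin
  ℚ.toℚᵘ ((a * b) /1)                            ≈⟨ toℚᵘ-/1 (a * b) ⟩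
  ℚᵘ.mkℚᵘ (+ (a * b)) 0                          ≈⟨ ℚᵘ.*≡* (cong (ℤ._* + 1) (ℤₚ.pos-* a b)) ⟩
  ℚᵘ.mkℚᵘ (+ a) 0 ℚᵘ.* ℚᵘ.mkℚᵘ (+ b) 0           ≈⟨ ℚᵘₚ.*-cong (ℚᵘₚ.≃-sym (toℚᵘ-/1 a)) (ℚᵘₚ.≃-sym (toℚᵘ-/1 b)) ⟩
  ℚ.toℚᵘ (a /1) ℚᵘ.* ℚ.toℚᵘ (b /1)               ≈⟨ ℚᵘₚ.≃-sym (ℚₚ.toℚᵘ-homo-* (a /1) (b /1)) ⟩
  ℚ.toℚᵘ (a /1 ℚ.* b /1)                         ∎)
  where open import Relation.Binary.Reasoning.Setoid ℚᵘₚ.≃-setoid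

/1-inverse : ∀ n .{{_ : NonZero n}} → n /1 ℚ.* (+ 1 ℚ./ n) ≡ ℚ.1ℚ
/1-inverse (suc n) = ℚₚ.toℚᵘ-injective (begin
  ℚ.toℚᵘ (suc n /1 ℚ.* (+ 1 ℚ./ suc n))              ≈⟨ ℚₚ.toℚᵘ-homo-* (suc n /1) (+ 1 ℚ./ suc n) ⟩
  ℚ.toℚᵘ (suc n /1) ℚᵘ.* ℚ.toℚᵘ (+ 1 ℚ./ suc n)      ≈⟨ ℚᵘₚ.*-cong (toℚᵘ-/1 (suc n)) (ℚₚ.toℚᵘ-fromℚᵘ (ℚᵘ.mkℚᵘ (+ 1) n)) ⟩
  ℚᵘ.mkℚᵘ (+ suc n) 0 ℚᵘ.* ℚᵘ.mkℚᵘ (+ 1) n           ≈⟨ ℚᵘ.*≡* (trans (ℤₚ.*-identityʳ _) (trans (ℤₚ.*-identityʳ (+ suc n)) (cong +_ (sym (trans (+-identityʳ _) (+-identityʳ (suc n))))))) ⟩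
  ℚ.toℚᵘ ℚ.1ℚ                                        ∎)
  where open import Relation.Binary.Reasoning.Setoid ℚᵘₚ.≃-setoid

/1-mono : ∀ {a b} → a ≤ b → a /1 ℚ.≤ b /1
/1-mono {a} {b} le = ℚₚ.toℚᵘ-cancel-≤ (ℚᵘₚ.≤-respˡ-≃ (ℚᵘₚ.≃-sym (toℚᵘ-/1 a)) (ℚᵘₚ.≤-respʳ-≃ (ℚᵘₚ.≃-sym (toℚᵘ-/1 b))
  (ℚᵘ.*≤* (ℤₚ.*-monoʳ-≤-nonNeg (+ 1) (ℤ.+≤+ le)))))

product-/1 : ∀ {k} (n : Fin k → ℕ) → product (λ i → n i /1) ≡ ∏ n /1
product-/1 {zero}  n = refl
product-/1 {suc k} n = trans (cong (n zero /1 ℚ.*_) (product-/1 (n ∘ suc))) (sym (/1-* (n zero) _))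

cofactors-/1 : ∀ {k} (n : Fin k → ℕ) (v : Fin k → ℚ) → (∀ i → n i /1 ℚ.* v i ≡ ℚ.1ℚ) →
               product (λ i → n i /1) ℚ.* sum v ≡ cofactors n /1
cofactors-/1 {zero}  n v inv = refl
cofactors-/1 {suc k} n v inv = begin
  a ℚ.* P ℚ.* (v zero ℚ.+ S)                         ≡⟨ ℚₚ.*-distribˡ-+ (a ℚ.* P) (v zero) S ⟩
  a ℚ.* P ℚ.* v zero ℚ.+ a ℚ.* P ℚ.* S               ≡⟨ cong₂ ℚ._+_ head (trans (ℚₚ.*-assoc a P S) (cong (a ℚ.*_) (cofactors-/1 (n ∘ suc) (v ∘ suc) (inv ∘ suc)))) ⟩
  ∏ (n ∘ suc) /1 ℚ.+ a ℚ.* cofactors (n ∘ suc) /1    ≡⟨ cong (∏ (n ∘ suc) /1 ℚ.+_) (sym (/1-* (n zero) _)) ⟩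
  ∏ (n ∘ suc) /1 ℚ.+ (n zero * cofactors (n ∘ suc)) /1 ≡⟨ sym (/1-+ (∏ (n ∘ suc)) _) ⟩
  cofactors n /1                                     ∎
  where
  open ≡-Reasoning
  a P S : ℚ
  a = n zero /1
  P = product (λ i → n (suc i) /1)
  S = sum (v ∘ suc)
  head : a ℚ.* P ℚ.* v zero ≡ ∏ (n ∘ suc) /1
  head = begin
    a ℚ.* P ℚ.* v zero       ≡⟨ cong (ℚ._* v zero) (ℚₚ.*-comm a P) ⟩
    P ℚ.* a ℚ.* v zero       ≡⟨ ℚₚ.*-assoc P a (v zero) ⟩
    P ℚ.* (a ℚ.* v zero)     ≡⟨ cong (P ℚ.*_) (inv zero) ⟩
    P ℚ.* ℚ.1ℚ               ≡⟨ ℚₚ.*-identityʳ P ⟩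
    P                        ≡⟨ product-/1 (n ∘ suc) ⟩
    ∏ (n ∘ suc) /1           ∎

ramsey-number : ∀ {k C} → RamseyBound (2 + k) C → ∀ (T : Fin (2 + k) → OrientedTree) →
                ∃ λ r → IsRamseyNumber (λ i → OrientedTree.digraph (T i)) r ×
                        r /1 ℚ.≤ C /1 ℚ.* product (λ i → ∣ T i ∣) ℚ.* sum (λ i → 1/∣ T i ∣)
ramsey-number {k} {C} bound T =
  let r , isRamsey , r≤ = least (λ n → arrows? n (OrientedTree.digraph ∘ T)) (ramsey-arrows bound T)
  in r , isRamsey , ℚₚ.≤-trans (/1-mono r≤) (ℚₚ.≤-reflexive value)
  where
  value : (C * cofactors (OrientedTree.order ∘ T)) /1 ≡ C /1 ℚ.* product (λ i → ∣ T i ∣) ℚ.* sum (λ i → 1/∣ T i ∣)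
  value = trans (/1-* C _) (trans (cong (C /1 ℚ.*_) (sym (cofactors-/1 (OrientedTree.order ∘ T) (λ i → 1/∣ T i ∣)
            (λ i → /1-inverse (OrientedTree.order (T i)) {{OrientedTree.nonempty (T i)}}))))
            (sym (ℚₚ.*-assoc (C /1) (product λ i → ∣ T i ∣) (sum λ i → 1/∣ T i ∣))))

mainTheorem5 : ∀ (k : ℕ) → 2 ≤ k →
    ∃ λ (c : ℚ) →
    ∀ (T : Fin k → OrientedTree) →
    ∃ λ (r : ℕ) →
    IsRamseyNumber (λ i → OrientedTree.digraph (T i)) r ×
    (+ r ℚ./ 1) ℚ.≤ c ℚ.* product (λ i → ∣ T i ∣) ℚ.* sum (λ i → 1/∣ T i ∣)
mainTheorem5 (suc (suc k)) (s≤s (s≤s z≤n)) =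
  proj₁ (ramsey-bound k) /1 , ramsey-number (proj₂ (ramsey-bound k))
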